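{- Let $\alpha_k$ be defined by $\alpha_k=q^{3r^2-2r}$ if $k=3r-1$, $\alpha_k=q^{3r^2+2r}$ if $k=3r$, $\alpha_k=-q^{3r^2+4r+1}-q^{3r^2+2r}$ if $k=3r+1$. Then for every integer $p\ge1$, every positive integer $N$ and every primitive $N$th root of unity $q$, $$H_p^{(4)}(q)=\sum_{k=0}^{N-1}(-1)^kq^{\binom{k+1}{2}+(p-1)(k^2+k)}\alpha_k.$$
   Context: $(a)_n=\prod_{k=1}^n(1-aq^{k-1})$, $\begin{bmatrix} n\\ k\end{bmatrix}=\frac{(q)_n}{(q)_{n-k}(q)_k}$. $H_p^{(4)}(q)=\sum_{n_p\ge\cdots\ge n_1\ge0}q^{n_p}(q^{n_p+1})_{n_p}\prod_{i=1}^{p-1}q^{n_i(n_i+1)}\begin{bmatrix} n_{i+1}\\ n_i\end{bmatrix}$; at a root of unity only finitely many terms are nonzero. -}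

module Defs where

open import Level using (Level)
open import Data.Nat as ℕ using (ℕ; zero; suc; _/_; _%_; _∸_)
open import Data.Nat.Combinatorics using (_C_)
open import Algebra.Bundles using (CommutativeRing)

module WithRing {c ℓ : Level} (R : CommutativeRing c ℓ) where
  open CommutativeRing R

  pow : Carrier → ℕ → Carrier
  pow x zero    = 1#
  pow x (suc n) = x * pow x n

  sumTo : ℕ → (ℕ → Carrier) → Carrier
  sumTo zero    f = f 0
  sumTo (suc n) f = sumTo n f + f (suc n)

  sumBelow : ℕ → (ℕ → Carrier) → Carrier
  sumBelow zero    f = 0#
  sumBelow (suc n) f = sumBelow n f + f n

  module _ (q : Carrier) where

    qPoch : Carrier → ℕ → Carrier
    qPoch a zero    = 1#
    qPoch a (suc n) = qPoch a n * (1# - a * pow q n)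

    -- Gaussian binomial [n k] as the polynomial in q (q-Pascal recursion)
    qBinom : ℕ → ℕ → Carrier
    qBinom n       zero    = 1#
    qBinom zero    (suc k) = 0#
    qBinom (suc n) (suc k) = qBinom n k + pow q (suc k) * qBinom n (suc k)

    -- inner j n = Σ_{n ≥ m_j ≥ ... ≥ m_1 ≥ 0} ∏ q^{m_i(m_i+1)} [m_{i+1} m_i]  (with m_{j+1} = n)
    inner : ℕ → ℕ → Carrier
    inner zero    n = 1#
    inner (suc j) n = sumTo n (λ m → pow q (m ℕ.* suc m) * qBinom n m * inner j m)

    Htrunc : ℕ → ℕ → Carrier
    Htrunc p M = sumTo M (λ n → pow q n * qPoch (pow q (suc n)) n * inner (p ∸ 1) n)

    alphaRS : ℕ → ℕ → Carrier
    alphaRS r 0 = pow q (3 ℕ.* r ℕ.* r ℕ.+ 2 ℕ.* r)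
    alphaRS r 1 = - pow q (3 ℕ.* r ℕ.* r ℕ.+ 4 ℕ.* r ℕ.+ 1) - pow q (3 ℕ.* r ℕ.* r ℕ.+ 2 ℕ.* r)
    -- k = 3r + 2 = 3(r+1) - 1 : q^{3(r+1)^2 - 2(r+1)}
    alphaRS r _ = pow q (3 ℕ.* suc r ℕ.* suc r ∸ 2 ℕ.* suc r)

    alpha : ℕ → Carrier
    alpha k = alphaRS (k / 3) (k % 3)

    rhs : ℕ → ℕ → Carrier
    rhs p N = sumBelow N (λ k →
      pow (- 1#) k * pow q ((suc k C 2) ℕ.+ (p ∸ 1) ℕ.* (k ℕ.* k ℕ.+ k)) * alpha k)

{-# OPTIONS --safe #-}
module Submission where

-- Iterating the Bailey step from the unit pair, and interchanging summations, turns
-- H_p into Σ_{2r<N} w_r (U_r - U_{r+1}), where w_r = (-1)^r q^{C(r+1,2) + (p-1)(r²+r)}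
-- and U_r = q^{r²} Σ_{2n<N} q^n [2n, n-r] no longer depends on p.
-- At a primitive N-th root of unity 1 - q^{N-k} = -q^{-k} (1 - q^k), which reflects
-- [2n, n-r] into [N-1-n-r, n-r]; U_r then becomes a q-Fibonacci sum
-- Σ_i (-1)^i x^i q^{i² + i(i+1)/2} [M-i, i] with x q^M = 1, M = N-1-2r, whose two
-- recurrences combine into a recurrence M → M + 3 with a single term.
-- Evaluating it gives U_r = V_{N-r} - V_r with V_k = χ(k) q^{(k²-1)/3}, χ the nontrivial
-- character modulo 3, while α_k = V_{k+1} - V_k. Since w_{N-1-k} = w_k, pairing the
-- indices k and N-1-k on the right-hand side gives the same sum.

open import Defs
open import Level using (Level; _⊔_)
open import Data.Nat using (ℕ; _≤_; _<_)
open import Data.Sum using (_⊎_)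
open import Relation.Nullary using (¬_)
open import Algebra.Bundles using (CommutativeRing)

import Algebra.Properties.Ring as RingProperties
import Algebra.Properties.AbelianGroup as AbelianGroupProperties
import Algebra.Properties.Semiring.Mult.TCOptimised as Multiples
import Algebra.Solver.Ring as RingSolver
import Relation.Binary.Reasoning.Setoid as SetoidReasoning
open import Algebra.Solver.Ring.AlmostCommutativeRing using (fromCommutativeRing; _-Raw-AlmostCommutative⟶_)
open import Data.Integer as ℤ using (ℤ; +_; -[1+_]; _⊖_)
import Data.Integer.Properties as ℤₚ
open import Data.Maybe using (Maybe; just; nothing)
open import Data.Nat as ℕ using (zero; suc; z≤n; s≤s; _∸_; _/_; _%_)
open import Data.Nat.Combinatorics using (_C_; nCk+nC[k+1]≡[n+1]C[k+1]; nC1≡n)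
open import Data.Nat.Divisibility using (divides-refl)
open import Data.Nat.DivMod using ([m+kn]%n≡m%n; m*n/n≡m; +-distrib-/-∣ʳ)
import Data.Nat.Properties as ℕₚ
open import Data.Nat.Tactic.RingSolver using (solve-∀)
open import Data.Product using (_×_; _,_; proj₁; proj₂; ∃-syntax)
open import Data.Sum using (inj₁; inj₂)
open import Data.Empty using (⊥-elim)
open import Relation.Nullary using (yes; no)
open import Relation.Binary.PropositionalEquality as ≡ using (_≡_)

-- The obstacle is division. At a primitive N-th root of unity (q)_n vanishes for n ≥ N, so the
-- Bailey relations are cleared of denominators, restricted to 2n < N, and proved by cancelling
-- products that are nonzero in an integral domain. This range suffices because (q^(n+1))_n contains
-- a factor 1 - q^(yN) as soon as 2n ≥ N. Exponents are natural numbers. A negative exponent is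
-- therefore represented modulo N, and a sign is converted by q^e = (-1)^k whenever 2e = kN. The
-- character modulo 3 comes from the recurrence M → M + 3: its starting values at M = 0, 1, 2 are 1,
-- 1 and 1 - x q^2, and the last one vanishes when x q^2 = 1. If 3 divides N, the sum U_r can be a
-- single power of q while V_(N-r) - V_r has two terms; the relation 1 + ω + ω² = 0 for ω = q^(N/3)
-- reconciles them.

-- Integer coefficients for the ring solver.

module IntegerCoefficients {c ℓ : Level} (R : CommutativeRing c ℓ) where
  open CommutativeRing R
  open RingProperties ring using (-‿distribˡ-*; -‿distribʳ-*)
  open AbelianGroupProperties +-abelianGroup using (⁻¹-∙-comm; ⁻¹-involutive; ε⁻¹≈ε)
  open Multiples semiring renaming (_×_ to _·_)
  open SetoidReasoning setoid

  -- The solver needs coefficients whose equality can be tested, which an arbitrary commutative ring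
  -- does not offer; integer coefficients let it cancel terms. With the optimised multiple, `1 · 1#`
  -- is `1#` by definition, so `1-homo` is `refl`.
  fromℤ : ℤ → Carrier
  fromℤ (+ n)    = n · 1#
  fromℤ -[1+ n ] = - (suc n · 1#)

  suc-· : ∀ n → suc n · 1# ≈ 1# + n · 1#
  suc-· n = ×-homo-+ 1# 1 n

  fromℤ-⊖ : ∀ m n → fromℤ (m ⊖ n) ≈ m · 1# - n · 1#
  fromℤ-⊖ m       zero    = sym (trans (+-congˡ ε⁻¹≈ε) (+-identityʳ _))
  fromℤ-⊖ zero    (suc n) = sym (+-identityˡ _)
  fromℤ-⊖ (suc m) (suc n) = begin
    fromℤ (suc m ⊖ suc n)                ≡⟨ ≡.cong fromℤ (ℤₚ.[1+m]⊖[1+n]≡m⊖n m n) ⟩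
    fromℤ (m ⊖ n)                        ≈⟨ fromℤ-⊖ m n ⟩
    m · 1# - n · 1#                      ≈⟨ +-congʳ (sym (trans (+-congʳ (-‿inverseʳ 1#)) (+-identityˡ _))) ⟩
    1# - 1# + m · 1# - n · 1#            ≈⟨ +-congʳ (trans (+-assoc _ _ _) (trans (+-congˡ (+-comm _ _)) (sym (+-assoc _ _ _)))) ⟩
    1# + m · 1# - 1# - n · 1#            ≈⟨ +-assoc _ _ _ ⟩
    1# + m · 1# + (- 1# - n · 1#)        ≈⟨ +-congˡ (⁻¹-∙-comm 1# (n · 1#)) ⟩
    1# + m · 1# - (1# + n · 1#)          ≈⟨ +-cong (sym (suc-· m)) (-‿cong (sym (suc-· n))) ⟩
    suc m · 1# - suc n · 1#              ∎

  fromℤ-neg : ∀ i → fromℤ (ℤ.- i) ≈ - fromℤ i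
  fromℤ-neg (+ zero)  = sym ε⁻¹≈ε
  fromℤ-neg (+ suc n) = refl
  fromℤ-neg -[1+ n ]  = sym (⁻¹-involutive _)

  fromℤ-+ : ∀ i j → fromℤ (i ℤ.+ j) ≈ fromℤ i + fromℤ j
  fromℤ-+ (+ m)    (+ n)    = ×-homo-+ 1# m n
  fromℤ-+ (+ m)    -[1+ n ] = fromℤ-⊖ m (suc n)
  fromℤ-+ -[1+ m ] (+ n)    = trans (fromℤ-⊖ n (suc m)) (+-comm _ _)
  fromℤ-+ -[1+ m ] -[1+ n ] = begin
    - (suc (suc (m ℕ.+ n)) · 1#)      ≡⟨ ≡.cong (λ k → - (suc k · 1#)) (≡.sym (ℕₚ.+-suc m n)) ⟩
    - ((suc m ℕ.+ suc n) · 1#)        ≈⟨ -‿cong (×-homo-+ 1# (suc m) (suc n)) ⟩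
    - (suc m · 1# + suc n · 1#)       ≈⟨ sym (⁻¹-∙-comm _ _) ⟩
    - (suc m · 1#) - suc n · 1#       ∎

  fromℤ-*-+ : ∀ m j → fromℤ (+ m ℤ.* j) ≈ m · 1# * fromℤ j
  fromℤ-*-+ m (+ n) = trans (reflexive (≡.cong fromℤ (≡.sym (ℤₚ.pos-* m n)))) (×1-homo-* m n)
  fromℤ-*-+ m -[1+ n ] = begin
    fromℤ (+ m ℤ.* -[1+ n ])        ≡⟨ ≡.cong fromℤ (≡.sym (ℤₚ.neg-distribʳ-* (+ m) (+ suc n))) ⟩
    fromℤ (ℤ.- (+ m ℤ.* + suc n))   ≈⟨ fromℤ-neg (+ m ℤ.* + suc n) ⟩
    - fromℤ (+ m ℤ.* + suc n)       ≈⟨ -‿cong (fromℤ-*-+ m (+ suc n)) ⟩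
    - (m · 1# * (suc n · 1#))       ≈⟨ -‿distribʳ-* _ _ ⟩
    m · 1# * - (suc n · 1#)         ∎

  fromℤ-* : ∀ i j → fromℤ (i ℤ.* j) ≈ fromℤ i * fromℤ j
  fromℤ-* (+ m)    j = fromℤ-*-+ m j
  fromℤ-* -[1+ m ] j = begin
    fromℤ (-[1+ m ] ℤ.* j)        ≡⟨ ≡.cong fromℤ (≡.sym (ℤₚ.neg-distribˡ-* (+ suc m) j)) ⟩
    fromℤ (ℤ.- (+ suc m ℤ.* j))   ≈⟨ fromℤ-neg (+ suc m ℤ.* j) ⟩
    - fromℤ (+ suc m ℤ.* j)       ≈⟨ -‿cong (fromℤ-*-+ (suc m) j) ⟩
    - (suc m · 1# * fromℤ j)      ≈⟨ -‿distribˡ-* _ _ ⟩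
    - (suc m · 1#) * fromℤ j      ∎

  fromℤ-≟ : ∀ i j → Maybe (fromℤ i ≈ fromℤ j)
  fromℤ-≟ i j with i ℤ.≟ j
  ... | yes i≡j = just (reflexive (≡.cong fromℤ i≡j))
  ... | no _    = nothing

  morphism : ℤ.+-*-rawRing -Raw-AlmostCommutative⟶ fromCommutativeRing R
  morphism = record
    { ⟦_⟧    = fromℤ
    ; +-homo = fromℤ-+
    ; *-homo = fromℤ-*
    ; -‿homo = fromℤ-neg
    ; 0-homo = refl
    ; 1-homo = refl
    }

  open RingSolver ℤ.+-*-rawRing (fromCommutativeRing R) morphism fromℤ-≟ public
    using (Polynomial; solve; _:+_; _:*_; _:-_; :-_; con; _:=_)

  :1 : ∀ {n} → Polynomial n
  :1 = con (+ 1)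

  :0 : ∀ {n} → Polynomial n
  :0 = con (+ 0)

-- Powers and finite sums.

module PowersAndSums {c ℓ : Level} (R : CommutativeRing c ℓ) where
  open CommutativeRing R
  open WithRing R
  open IntegerCoefficients R
  open SetoidReasoning setoid

  Nontrivial : Set ℓ
  Nontrivial = ¬ (1# ≈ 0#)

  NoZeroDivisors : Set (c ⊔ ℓ)
  NoZeroDivisors = ∀ x y → x * y ≈ 0# → x ≈ 0# ⊎ y ≈ 0#

  PrimitiveRoot : ℕ → Carrier → Set ℓ
  PrimitiveRoot n x = pow x n ≈ 1# × (∀ j → 1 ≤ j → j < n → ¬ (pow x j ≈ 1#))

  pow-≡ : ∀ x {m n} → m ≡ n → pow x m ≈ pow x n
  pow-≡ x m≡n = reflexive (≡.cong (pow x) m≡n)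

  pow-+ : ∀ x m n → pow x (m ℕ.+ n) ≈ pow x m * pow x n
  pow-+ x zero    n = sym (*-identityˡ _)
  pow-+ x (suc m) n = trans (*-congˡ (pow-+ x m n)) (sym (*-assoc _ _ _))

  pow-*₂ : ∀ x m n {k} → m ℕ.+ n ≡ k → pow x m * pow x n ≈ pow x k
  pow-*₂ x m n m+n≡k = trans (sym (pow-+ x m n)) (pow-≡ x m+n≡k)

  pow-*₃ : ∀ x l m n {k} → l ℕ.+ m ℕ.+ n ≡ k → pow x l * pow x m * pow x n ≈ pow x k
  pow-*₃ x l m n eq = trans (*-congʳ (pow-*₂ x l m ≡.refl)) (pow-*₂ x (l ℕ.+ m) n eq)

  pow-cong : ∀ {x y} n → x ≈ y → pow x n ≈ pow y n
  pow-cong zero    x≈y = refl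
  pow-cong (suc n) x≈y = *-cong x≈y (pow-cong n x≈y)

  pow-1# : ∀ n → pow 1# n ≈ 1#
  pow-1# zero    = refl
  pow-1# (suc n) = trans (*-identityˡ _) (pow-1# n)

  pow-distrib-* : ∀ x y n → pow (x * y) n ≈ pow x n * pow y n
  pow-distrib-* x y zero    = sym (*-identityˡ _)
  pow-distrib-* x y (suc n) = trans (*-congˡ (pow-distrib-* x y n))
    (solve 4 (λ a b c d → a :* b :* (c :* d) := a :* c :* (b :* d)) refl x y (pow x n) (pow y n))

  pow-pow : ∀ x m n → pow (pow x m) n ≈ pow x (n ℕ.* m)
  pow-pow x m zero    = refl
  pow-pow x m (suc n) = trans (*-congˡ (pow-pow x m n)) (sym (pow-+ x m (n ℕ.* m)))

  sign² : ∀ n → pow (- 1#) n * pow (- 1#) n ≈ 1#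
  sign² n = begin
    pow (- 1#) n * pow (- 1#) n ≈⟨ sym (pow-distrib-* (- 1#) (- 1#) n) ⟩
    pow (- 1# * - 1#) n         ≈⟨ pow-cong n (solve 0 (:- :1 :* :- :1 := :1) refl) ⟩
    pow 1# n                    ≈⟨ pow-1# n ⟩
    1#                          ∎

  sum-cong< : ∀ n {f g} → (∀ k → k < n → f k ≈ g k) → sumBelow n f ≈ sumBelow n g
  sum-cong< zero    f≈g = refl
  sum-cong< (suc n) f≈g = +-cong (sum-cong< n (λ k k<n → f≈g k (ℕₚ.m<n⇒m<1+n k<n))) (f≈g n ℕₚ.≤-refl)

  sum-cong : ∀ n {f g} → (∀ k → f k ≈ g k) → sumBelow n f ≈ sumBelow n g
  sum-cong n f≈g = sum-cong< n (λ k _ → f≈g k)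

  sum-0 : ∀ n → sumBelow n (λ _ → 0#) ≈ 0#
  sum-0 zero    = refl
  sum-0 (suc n) = trans (+-identityʳ _) (sum-0 n)

  sum-zero : ∀ n {f} → (∀ k → k < n → f k ≈ 0#) → sumBelow n f ≈ 0#
  sum-zero n f≈0 = trans (sum-cong< n f≈0) (sum-0 n)

  sum-+ : ∀ n f g → sumBelow n (λ k → f k + g k) ≈ sumBelow n f + sumBelow n g
  sum-+ zero    f g = sym (+-identityˡ _)
  sum-+ (suc n) f g = trans (+-congʳ (sum-+ n f g))
    (solve 4 (λ a b c d → a :+ b :+ (c :+ d) := a :+ c :+ (b :+ d)) refl _ _ _ _)

  sum-- : ∀ n f g → sumBelow n (λ k → f k - g k) ≈ sumBelow n f - sumBelow n g
  sum-- zero    f g = sym (-‿inverseʳ 0#)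
  sum-- (suc n) f g = trans (+-congʳ (sum-- n f g))
    (solve 4 (λ a b c d → a :- b :+ (c :- d) := a :+ c :- (b :+ d)) refl _ _ _ _)

  sum-*ˡ : ∀ n x f → sumBelow n (λ k → x * f k) ≈ x * sumBelow n f
  sum-*ˡ zero    x f = sym (zeroʳ x)
  sum-*ˡ (suc n) x f = trans (+-congʳ (sum-*ˡ n x f)) (sym (distribˡ x _ _))

  sum-head : ∀ n f → sumBelow (suc n) f ≈ f 0 + sumBelow n (λ k → f (suc k))
  sum-head zero    f = +-comm _ _
  sum-head (suc n) f = trans (+-congʳ (sum-head n f)) (+-assoc _ _ _)

  sum-split : ∀ m n f → sumBelow (m ℕ.+ n) f ≈ sumBelow m f + sumBelow n (λ k → f (m ℕ.+ k))
  sum-split zero    n f = sym (+-identityˡ _)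
  sum-split (suc m) n f = begin
    sumBelow (suc (m ℕ.+ n)) f
      ≈⟨ sum-head (m ℕ.+ n) f ⟩
    f 0 + sumBelow (m ℕ.+ n) (λ k → f (suc k))
      ≈⟨ +-congˡ (sum-split m n (λ k → f (suc k))) ⟩
    f 0 + (sumBelow m (λ k → f (suc k)) + sumBelow n (λ k → f (suc (m ℕ.+ k))))
      ≈⟨ sym (+-assoc _ _ _) ⟩
    f 0 + sumBelow m (λ k → f (suc k)) + sumBelow n (λ k → f (suc (m ℕ.+ k)))
      ≈⟨ +-congʳ (sym (sum-head m f)) ⟩
    sumBelow (suc m) f + sumBelow n (λ k → f (suc m ℕ.+ k)) ∎

  sum-extend : ∀ {m n} f → m ≤ n → (∀ k → m ≤ k → k < n → f k ≈ 0#) → sumBelow n f ≈ sumBelow m f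
  sum-extend {m} {n} f m≤n f≈0 with ℕₚ.m≤n⇒∃[o]m+o≡n m≤n
  ... | (d , ≡.refl) = begin
    sumBelow (m ℕ.+ d) f                             ≈⟨ sum-split m d f ⟩
    sumBelow m f + sumBelow d (λ k → f (m ℕ.+ k))     ≈⟨ +-congˡ (sum-zero d (λ k k<d → f≈0 (m ℕ.+ k) (ℕₚ.m≤m+n m k) (ℕₚ.+-monoʳ-< m k<d))) ⟩
    sumBelow m f + 0#                                ≈⟨ +-identityʳ _ ⟩
    sumBelow m f                                     ∎

  sum-reverse : ∀ n f → sumBelow n f ≈ sumBelow n (λ k → f (n ∸ suc k))
  sum-reverse zero    f = refl
  sum-reverse (suc n) f = begin
    sumBelow n f + f n                             ≈⟨ +-comm _ _ ⟩
    f n + sumBelow n f                             ≈⟨ +-congˡ (sum-reverse n f) ⟩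
    f n + sumBelow n (λ k → f (n ∸ suc k))         ≈⟨ sym (sum-head n (λ k → f (n ∸ k))) ⟩
    sumBelow (suc n) (λ k → f (n ∸ k))             ∎

  sum-swap : ∀ m n (f : ℕ → ℕ → Carrier) → sumBelow m (λ i → sumBelow n (f i)) ≈ sumBelow n (λ j → sumBelow m (λ i → f i j))
  sum-swap zero    n f = sym (sum-0 n)
  sum-swap (suc m) n f = trans (+-congʳ (sum-swap m n f)) (sym (sum-+ n _ (f m)))

  sumTo≈sumBelow : ∀ n f → sumTo n f ≈ sumBelow (suc n) f
  sumTo≈sumBelow zero    f = sym (+-identityˡ _)
  sumTo≈sumBelow (suc n) f = +-congʳ (sumTo≈sumBelow n f)

-- Triangular numbers, parity and residues modulo 3.

-- This is n(n-1)/2, with the index shift of the q-binomial theorem: k(k+1)/2 is `triangle (suc k)`.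
triangle : ℕ → ℕ
triangle zero    = 0
triangle (suc n) = n ℕ.+ triangle n

triangle-+ : ∀ m n → triangle (m ℕ.+ n) ≡ triangle m ℕ.+ triangle n ℕ.+ m ℕ.* n
triangle-+ zero    n = ≡.sym (ℕₚ.+-identityʳ (triangle n))
triangle-+ (suc m) n = ≡.trans (≡.cong (m ℕ.+ n ℕ.+_) (triangle-+ m n)) (arith m n (triangle m) (triangle n))
  where
  arith : ∀ m n a b → m ℕ.+ n ℕ.+ (a ℕ.+ b ℕ.+ m ℕ.* n) ≡ m ℕ.+ a ℕ.+ b ℕ.+ (n ℕ.+ m ℕ.* n)
  arith = solve-∀

triangle-double : ∀ n → triangle (suc n) ℕ.+ triangle (suc n) ≡ n ℕ.* suc n
triangle-double zero    = ≡.refl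
triangle-double (suc n) = ≡.trans (arith₁ n (triangle (suc n))) (≡.trans (≡.cong (suc n ℕ.+ suc n ℕ.+_) (triangle-double n)) (arith₂ n))
  where
  arith₁ : ∀ n t → suc n ℕ.+ t ℕ.+ (suc n ℕ.+ t) ≡ suc n ℕ.+ suc n ℕ.+ (t ℕ.+ t)
  arith₁ = solve-∀
  arith₂ : ∀ n → suc n ℕ.+ suc n ℕ.+ n ℕ.* suc n ≡ suc n ℕ.* suc (suc n)
  arith₂ = solve-∀

C2≡triangle : ∀ n → n C 2 ≡ triangle n
C2≡triangle zero    = ≡.refl
C2≡triangle (suc n) = ≡.trans (≡.sym (nCk+nC[k+1]≡[n+1]C[k+1] n 1)) (≡.cong₂ ℕ._+_ (nC1≡n n) (C2≡triangle n))

double-injective : ∀ m n → m ℕ.+ m ≡ n ℕ.+ n → m ≡ n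
double-injective zero    zero    _  = ≡.refl
double-injective (suc m) (suc n) eq = ≡.cong suc (double-injective m n
  (ℕₚ.suc-injective (≡.trans (≡.sym (ℕₚ.+-suc m m)) (≡.trans (ℕₚ.suc-injective eq) (ℕₚ.+-suc n n)))))

even≢odd : ∀ m n → ¬ (m ℕ.+ m ≡ suc (n ℕ.+ n))
even≢odd (suc m) n eq = even≢odd n m (≡.sym (≡.trans (≡.sym (ℕₚ.+-suc m m)) (ℕₚ.suc-injective eq)))

data Parity : ℕ → Set where
  even : ∀ m → Parity (m ℕ.+ m)
  odd  : ∀ m → Parity (suc (m ℕ.+ m))

parity : ∀ n → Parity n
parity zero    = even 0
parity (suc n) with parity n
... | even m = odd m
... | odd m  = ≡.subst Parity (≡.cong suc (ℕₚ.+-suc m m)) (even (suc m))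

data Residue₃ : ℕ → Set where
  0+3* : ∀ t → Residue₃ (t ℕ.* 3)
  1+3* : ∀ t → Residue₃ (1 ℕ.+ t ℕ.* 3)
  2+3* : ∀ t → Residue₃ (2 ℕ.+ t ℕ.* 3)

residue₃ : ∀ n → Residue₃ n
residue₃ zero    = 0+3* 0
residue₃ (suc n) with residue₃ n
... | 0+3* t = 1+3* t
... | 1+3* t = 2+3* t
... | 2+3* t = 0+3* (suc t)

[c+t*3]/3 : ∀ c t → (c ℕ.+ t ℕ.* 3) / 3 ≡ c / 3 ℕ.+ t
[c+t*3]/3 c t = ≡.trans (+-distrib-/-∣ʳ c (divides-refl t)) (≡.cong (c / 3 ℕ.+_) (m*n/n≡m t 3))

[c+t*3]%3 : ∀ c t → (c ℕ.+ t ℕ.* 3) % 3 ≡ c % 3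
[c+t*3]%3 c t = [m+kn]%n≡m%n c t 3

m+m≤1+n+n⇒m≤n : ∀ m n → m ℕ.+ m ≤ suc (n ℕ.+ n) → m ≤ n
m+m≤1+n+n⇒m≤n m n 2m≤1+2n = ℕₚ.≮⇒≥ (λ n<m → ℕₚ.<⇒≱
  (ℕₚ.≤-trans (ℕₚ.≤-reflexive (≡.cong suc (≡.sym (ℕₚ.+-suc n n)))) (ℕₚ.+-mono-≤ n<m n<m)) 2m≤1+2n)

-- Slide the window by one: a multiple that drops out at the left end is replaced by the one m
-- places further, at offset m - 1.
multipleInWindow : ∀ m .{{_ : ℕ.NonZero m}} a l → m ≤ l → ∃[ k ] k < l × ∃[ y ] a ℕ.+ k ≡ y ℕ.* m
multipleInWindow m@(suc _) zero    l m≤l = 0 , ℕₚ.≤-trans (s≤s z≤n) m≤l , 0 , ≡.refl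
multipleInWindow m@(suc n) (suc a) l m≤l with multipleInWindow m a l m≤l
... | zero  , _   , y , eq = n , m≤l , suc y , ≡.trans (arith a n) (≡.cong (m ℕ.+_) eq)
  where
  arith : ∀ a n → suc a ℕ.+ n ≡ suc n ℕ.+ (a ℕ.+ 0)
  arith = solve-∀
... | suc k , k<l , y , eq = k , ℕₚ.<-trans ℕₚ.≤-refl k<l , y , ≡.trans (≡.sym (ℕₚ.+-suc a k)) eq

-- Gaussian binomials and q-factorials, for arbitrary q.

module QBinomials {c ℓ : Level} (R : CommutativeRing c ℓ) (q : CommutativeRing.Carrier R) where
  open CommutativeRing R
  open WithRing R
  open IntegerCoefficients R
  open PowersAndSums R
  open SetoidReasoning setoid

  qBinom-zero : ∀ {n k} → n < k → qBinom q n k ≈ 0#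
  qBinom-zero {zero}  {suc k} _         = refl
  qBinom-zero {suc n} {suc k} (s≤s n<k) = begin
    qBinom q n k + pow q (suc k) * qBinom q n (suc k)
      ≈⟨ +-cong (qBinom-zero n<k) (*-congˡ (qBinom-zero (ℕₚ.m<n⇒m<1+n n<k))) ⟩
    0# + pow q (suc k) * 0#  ≈⟨ solve 1 (λ a → :0 :+ a :* :0 := :0) refl _ ⟩
    0#                       ∎

  qBinom-diag : ∀ n → qBinom q n n ≈ 1#
  qBinom-diag zero    = refl
  qBinom-diag (suc n) = begin
    qBinom q n n + pow q (suc n) * qBinom q n (suc n)
      ≈⟨ +-cong (qBinom-diag n) (*-congˡ (qBinom-zero {n} ℕₚ.≤-refl)) ⟩
    1# + pow q (suc n) * 0#  ≈⟨ solve 1 (λ a → :1 :+ a :* :0 := :1) refl _ ⟩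
    1#                       ∎

  -- The mirror image of the Pascal recursion that defines `qBinom`. The defining recursion, applied
  -- to both sides, reduces it to two smaller instances; `d` stands for m - k and avoids truncated
  -- subtraction.
  qBinom-pascal′ : ∀ m k d → m ≡ k ℕ.+ d →
    qBinom q (suc m) (suc k) ≈ pow q d * qBinom q m k + qBinom q m (suc k)
  qBinom-pascal′ zero zero zero _ = solve 1 (λ a → :1 :+ a :* :0 := :1 :* :1 :+ :0) refl _
  qBinom-pascal′ (suc m) zero (suc .m) ≡.refl = begin
    1# + q * 1# * qBinom q (suc m) 1
      ≈⟨ +-congˡ (*-congˡ (qBinom-pascal′ m 0 m ≡.refl)) ⟩
    1# + q * 1# * (pow q m * 1# + qBinom q m 1)
      ≈⟨ solve 3 (λ q a b → :1 :+ q :* :1 :* (a :* :1 :+ b) := q :* a :* :1 :+ (:1 :+ q :* :1 :* b)) refl q (pow q m) (qBinom q m 1) ⟩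
    q * pow q m * 1# + (1# + q * 1# * qBinom q m 1) ∎
  qBinom-pascal′ (suc m) (suc k) zero eq with ≡.trans (ℕₚ.suc-injective eq) (ℕₚ.+-identityʳ k)
  ... | ≡.refl = begin
    qBinom q (suc m) (suc m) + pow q (suc (suc m)) * qBinom q (suc m) (suc (suc m))
      ≈⟨ +-congˡ (*-congˡ big≈0) ⟩
    qBinom q (suc m) (suc m) + pow q (suc (suc m)) * 0#
      ≈⟨ solve 2 (λ a b → a :+ b :* :0 := :1 :* a :+ :0) refl _ _ ⟩
    1# * qBinom q (suc m) (suc m) + 0#
      ≈⟨ +-congˡ (sym big≈0) ⟩
    1# * qBinom q (suc m) (suc m) + qBinom q (suc m) (suc (suc m)) ∎
    where
    big≈0 : qBinom q (suc m) (suc (suc m)) ≈ 0#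
    big≈0 = qBinom-zero {suc m} ℕₚ.≤-refl
  qBinom-pascal′ (suc m) (suc k) (suc d) eq = begin
    qBinom q (suc m) (suc k) + pow q (2 ℕ.+ k) * qBinom q (suc m) (2 ℕ.+ k)
      ≈⟨ +-cong (qBinom-pascal′ m k (suc d) m≡k+1+d) (*-congˡ (qBinom-pascal′ m (suc k) d m≡1+k+d)) ⟩
    q * pow q d * a + b + q * (q * pow q k) * (pow q d * b + e)
      ≈⟨ solve 6 (λ q x y a b e → q :* y :* a :+ b :+ q :* (q :* x) :* (y :* b :+ e)
                              := q :* y :* (a :+ q :* x :* b) :+ (b :+ q :* (q :* x) :* e))
           refl q (pow q k) (pow q d) a b e ⟩
    q * pow q d * (a + q * pow q k * b) + (b + q * (q * pow q k) * e) ∎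
    where
    m≡k+1+d = ℕₚ.suc-injective eq
    m≡1+k+d = ≡.trans m≡k+1+d (ℕₚ.+-suc k d)
    a = qBinom q m k
    b = qBinom q m (suc k)
    e = qBinom q m (2 ℕ.+ k)

  -- Exchanging `a` and `b` exchanges the two Pascal recursions, so the induction closes.
  qBinom-sym : ∀ m a b → m ≡ a ℕ.+ b → qBinom q m a ≈ qBinom q m b
  qBinom-sym zero    zero    zero    _  = refl
  qBinom-sym (suc m) zero    (suc b) ≡.refl = sym (qBinom-diag (suc m))
  qBinom-sym (suc m) (suc a) zero    eq with ≡.trans eq (ℕₚ.+-identityʳ (suc a))
  ... | ≡.refl = qBinom-diag (suc m)
  qBinom-sym (suc m) (suc a) (suc b) eq = begin
    qBinom q m a + pow q (suc a) * qBinom q m (suc a)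
      ≈⟨ +-cong (qBinom-sym m a (suc b) m≡a+1+b) (*-congˡ (qBinom-sym m (suc a) b m≡1+a+b)) ⟩
    qBinom q m (suc b) + pow q (suc a) * qBinom q m b
      ≈⟨ +-comm _ _ ⟩
    pow q (suc a) * qBinom q m b + qBinom q m (suc b)
      ≈⟨ sym (qBinom-pascal′ m b (suc a) (≡.trans m≡1+a+b (ℕₚ.+-comm (suc a) b))) ⟩
    qBinom q (suc m) (suc b) ∎
    where
    m≡a+1+b = ℕₚ.suc-injective eq
    m≡1+a+b = ≡.trans m≡a+1+b (ℕₚ.+-suc a b)

  qPoch-+ : ∀ x m n → qPoch q x (m ℕ.+ n) ≈ qPoch q x m * qPoch q (x * pow q m) n
  qPoch-+ x m zero    = trans (reflexive (≡.cong (qPoch q x) (ℕₚ.+-identityʳ m))) (sym (*-identityʳ _))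
  qPoch-+ x m (suc n) = begin
    qPoch q x (m ℕ.+ suc n)
      ≈⟨ reflexive (≡.cong (qPoch q x) (ℕₚ.+-suc m n)) ⟩
    qPoch q x (m ℕ.+ n) * (1# - x * pow q (m ℕ.+ n))
      ≈⟨ *-cong (qPoch-+ x m n) (+-congˡ (-‿cong (*-congˡ (pow-+ q m n)))) ⟩
    qPoch q x m * qPoch q (x * pow q m) n * (1# - x * (pow q m * pow q n))
      ≈⟨ solve 5 (λ u v x a b → u :* v :* (:1 :- x :* (a :* b)) := u :* (v :* (:1 :- x :* a :* b))) refl _ _ x (pow q m) (pow q n) ⟩
    qPoch q x m * (qPoch q (x * pow q m) n * (1# - x * pow q m * pow q n)) ∎

  qPoch-cong : ∀ {x y} n → x ≈ y → qPoch q x n ≈ qPoch q y n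
  qPoch-cong zero    x≈y = refl
  qPoch-cong (suc n) x≈y = *-cong (qPoch-cong n x≈y) (+-congˡ (-‿cong (*-congʳ x≈y)))

  qPoch-head : ∀ x n → qPoch q x (suc n) ≈ (1# - x) * qPoch q (x * q) n
  qPoch-head x n = trans (qPoch-+ x 1 n)
    (*-cong (solve 1 (λ x → :1 :* (:1 :- x :* :1) := :1 :- x) refl x) (qPoch-cong n (*-congˡ (*-identityʳ q))))

  qFactorial : ℕ → Carrier
  qFactorial n = qPoch q q n

  qFactorial-+ : ∀ m n → qFactorial (m ℕ.+ n) ≈ qFactorial m * qPoch q (pow q (suc m)) n
  qFactorial-+ m n = qPoch-+ q m n

  -- The factorial formula in product form, valid also where q-factorials vanish. The induction
  -- rests on 1 - q^(a+b+2) = (1 - q^(a+1)) + q^(a+1) (1 - q^(b+1)).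
  qBinom-qFactorial : ∀ m a b → m ≡ a ℕ.+ b → qBinom q m a * (qFactorial a * qFactorial b) ≈ qFactorial m
  qBinom-qFactorial m zero b ≡.refl = solve 1 (λ a → :1 :* (:1 :* a) := a) refl _
  qBinom-qFactorial m (suc a) zero eq with ≡.trans eq (ℕₚ.+-identityʳ (suc a))
  ... | ≡.refl = trans (*-congʳ (qBinom-diag m)) (solve 1 (λ a → :1 :* (a :* :1) := a) refl _)
  qBinom-qFactorial (suc m) (suc a) (suc b) eq = begin
    (s + q * pow q a * t) * (qFactorial a * (1# - q * pow q a) * (qFactorial b * (1# - q * pow q b)))
      ≈⟨ solve 7 (λ s t q x y u v →
             (s :+ q :* x :* t) :* (u :* (:1 :- q :* x) :* (v :* (:1 :- q :* y)))
          := s :* (u :* (v :* (:1 :- q :* y))) :* (:1 :- q :* x) :+ t :* (u :* (:1 :- q :* x) :* v) :* (q :* x :* (:1 :- q :* y)))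
           refl s t q (pow q a) (pow q b) (qFactorial a) (qFactorial b) ⟩
    s * (qFactorial a * qFactorial (suc b)) * (1# - q * pow q a)
      + t * (qFactorial (suc a) * qFactorial b) * (q * pow q a * (1# - q * pow q b))
      ≈⟨ +-cong (*-congʳ (qBinom-qFactorial m a (suc b) m≡a+1+b)) (*-congʳ (qBinom-qFactorial m (suc a) b m≡1+a+b)) ⟩
    qFactorial m * (1# - q * pow q a) + qFactorial m * (q * pow q a * (1# - q * pow q b))
      ≈⟨ solve 4 (λ f q x y → f :* (:1 :- q :* x) :+ f :* (q :* x :* (:1 :- q :* y)) := f :* (:1 :- q :* (x :* (q :* y)))) refl _ q _ _ ⟩
    qFactorial m * (1# - q * (pow q a * pow q (suc b)))
      ≈⟨ *-congˡ (+-congˡ (-‿cong (*-congˡ (pow-*₂ q a (suc b) (≡.sym m≡a+1+b))))) ⟩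
    qFactorial m * (1# - q * pow q m) ∎
    where
    m≡a+1+b = ℕₚ.suc-injective eq
    m≡1+a+b = ≡.trans m≡a+1+b (ℕₚ.+-suc a b)
    s = qBinom q m a
    t = qBinom q m (suc a)

  -- The q-binomial theorem.

  -- By the q-binomial theorem this is (x)_m; `alternating-suc` splits off its first factor.
  alternating : ℕ → Carrier → Carrier
  alternating m x = sumBelow (suc m) (λ k → pow (- 1#) k * pow q (triangle k) * pow x k * qBinom q m k)

  alternating-suc : ∀ m x → alternating (suc m) x ≈ (1# - x) * alternating m (x * q)
  alternating-suc m x = begin
    sumBelow (2 ℕ.+ m) (λ k → w x k * qBinom q (suc m) k)
      ≈⟨ sum-head (suc m) _ ⟩
    w x 0 * 1# + sumBelow (suc m) (λ k → w x (suc k) * qBinom q (suc m) (suc k))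
      ≈⟨ +-cong (*-congˡ (refl {1#})) (trans (sum-cong (suc m) split) (sum-+ (suc m) _ _)) ⟩
    w x 0 * 1# + (sumBelow (suc m) (λ k → - x * (w (x * q) k * qBinom q m k)) + sumBelow (suc m) (λ k → w (x * q) (suc k) * qBinom q m (suc k)))
      ≈⟨ +-congˡ (+-congʳ (sum-*ˡ (suc m) (- x) _)) ⟩
    w x 0 * 1# + (- x * alternating m (x * q) + sumBelow (suc m) (λ k → w (x * q) (suc k) * qBinom q m (suc k)))
      ≈⟨ solve 3 (λ a b c → a :+ (b :+ c) := b :+ (a :+ c)) refl _ _ _ ⟩
    - x * alternating m (x * q) + (w (x * q) 0 * 1# + sumBelow (suc m) (λ k → w (x * q) (suc k) * qBinom q m (suc k)))
      ≈⟨ +-congˡ (sym (sum-head (suc m) _)) ⟩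
    - x * alternating m (x * q) + (alternating m (x * q) + w (x * q) (suc m) * qBinom q m (suc m))
      ≈⟨ +-congˡ (+-congˡ (*-congˡ (qBinom-zero {m} ℕₚ.≤-refl))) ⟩
    - x * alternating m (x * q) + (alternating m (x * q) + w (x * q) (suc m) * 0#)
      ≈⟨ solve 3 (λ x a b → :- x :* a :+ (a :+ b :* :0) := (:1 :- x) :* a) refl x _ _ ⟩
    (1# - x) * alternating m (x * q) ∎
    where
    w : Carrier → ℕ → Carrier
    w x k = pow (- 1#) k * pow q (triangle k) * pow x k
    split : ∀ k → w x (suc k) * qBinom q (suc m) (suc k) ≈ - x * (w (x * q) k * qBinom q m k) + w (x * q) (suc k) * qBinom q m (suc k)
    split k = begin
      - 1# * pow (- 1#) k * pow q (k ℕ.+ triangle k) * (x * pow x k) * (qBinom q m k + q * pow q k * qBinom q m (suc k))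
        -- The factor q^k by which consecutive triangular powers differ turns x^k into (x q)^k.
        ≈⟨ *-congʳ (*-congʳ (*-congˡ (pow-+ q k (triangle k)))) ⟩
      - 1# * pow (- 1#) k * (pow q k * pow q (triangle k)) * (x * pow x k) * (qBinom q m k + q * pow q k * qBinom q m (suc k))
        ≈⟨ solve 8 (λ s a t x y q b c → :- :1 :* s :* (a :* t) :* (x :* y) :* (b :+ q :* a :* c)
               := :- x :* (s :* t :* (y :* a) :* b) :+ :- :1 :* s :* (a :* t) :* (x :* q :* (y :* a)) :* c)
             refl (pow (- 1#) k) (pow q k) (pow q (triangle k)) x (pow x k) q (qBinom q m k) (qBinom q m (suc k)) ⟩
      - x * (pow (- 1#) k * pow q (triangle k) * (pow x k * pow q k) * qBinom q m k)
        + - 1# * pow (- 1#) k * (pow q k * pow q (triangle k)) * (x * q * (pow x k * pow q k)) * qBinom q m (suc k)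
        ≈⟨ +-cong (*-congˡ (*-congʳ (*-congˡ (sym (pow-distrib-* x q k)))))
                  (*-congʳ (*-cong (*-congˡ (sym (pow-+ q k (triangle k)))) (*-congˡ (sym (pow-distrib-* x q k))))) ⟩
      - x * (w (x * q) k * qBinom q m k) + w (x * q) (suc k) * qBinom q m (suc k) ∎

  -- The factor 1 - x q^j of (x)_m is zero; peeling j factors brings it to the front.
  alternating-zero : ∀ m j x → j < m → x * pow q j ≈ 1# → alternating m x ≈ 0#
  alternating-zero (suc m) zero x _ x≈1 = begin
    alternating (suc m) x             ≈⟨ alternating-suc m x ⟩
    (1# - x) * alternating m (x * q)  ≈⟨ *-congʳ (+-congˡ (-‿cong (trans (sym (*-identityʳ x)) x≈1))) ⟩
    (1# - 1#) * alternating m (x * q) ≈⟨ solve 1 (λ a → (:1 :- :1) :* a := :0) refl _ ⟩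
    0#                                ∎
  alternating-zero (suc m) (suc j) x (s≤s j<m) xq≈1 = begin
    alternating (suc m) x             ≈⟨ alternating-suc m x ⟩
    (1# - x) * alternating m (x * q)  ≈⟨ *-congˡ (alternating-zero m j (x * q) j<m (trans (*-assoc _ _ _) xq≈1)) ⟩
    (1# - x) * 0#                     ≈⟨ zeroʳ _ ⟩
    0#                                ∎

  -- A limiting q-Vandermonde sum.

  -- Divided by (xq)_n this is the sum of q^(i²) x^i [n, i] / (xq)_i, a limit of the
  -- q-Chu-Vandermonde sum and the finite form of Cauchy's Durfee-square identity.
  vandermonde : ℕ → Carrier → Carrier
  vandermonde n x = sumBelow (suc n) (λ i → pow q (i ℕ.* i) * pow x i * qBinom q n i * qPoch q (x * pow q (suc i)) (n ∸ i))

  -- Write V_n(x) for the sum. The mirrored Pascal recursion gives V_(n+1)(x) = y V_n(xq) + (1 - y)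
  -- V_n(x) with y = x q^(n+1), and the two weights add up to 1.
  vandermonde≈1 : ∀ n x → vandermonde n x ≈ 1#
  vandermonde≈1 zero    x = solve 0 (:0 :+ :1 :* :1 :* :1 :* :1 := :1) refl
  vandermonde≈1 (suc n) x = begin
    sumBelow (2 ℕ.+ n) (λ i → v i * qBinom q (suc n) i * p (suc n) i)
      ≈⟨ sum-head (suc n) _ ⟩
    v 0 * 1# * p (suc n) 0 + sumBelow (suc n) (λ i → v (suc i) * qBinom q (suc n) (suc i) * p n′ (suc i))
      ≈⟨ +-congˡ (trans (sum-cong< (suc n) split) (sum-+ (suc n) _ _)) ⟩
    v 0 * 1# * p (suc n) 0 + (sumBelow (suc n) (λ i → y * t (x * q) i) + sumBelow (suc n) (λ i → v (suc i) * qBinom q n (suc i) * p n′ (suc i)))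
      ≈⟨ solve 3 (λ a b c → a :+ (b :+ c) := b :+ (a :+ c)) refl _ _ _ ⟩
    sumBelow (suc n) (λ i → y * t (x * q) i) + (v 0 * 1# * p n′ 0 + sumBelow (suc n) (λ i → v (suc i) * qBinom q n (suc i) * p n′ (suc i)))
      ≈⟨ +-cong (sum-*ˡ (suc n) y _) (sym (sum-head (suc n) (λ i → v i * qBinom q n i * p n′ i))) ⟩
    y * vandermonde n (x * q) + (sumBelow (suc n) (λ i → v i * qBinom q n i * p n′ i) + v (suc n) * qBinom q n (suc n) * p n′ (suc n))
      ≈⟨ +-congˡ (+-cong (trans (sum-cong< (suc n) peel) (sum-*ˡ (suc n) (1# - y) _)) (*-congʳ (*-congˡ (qBinom-zero {n} ℕₚ.≤-refl)))) ⟩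
    y * vandermonde n (x * q) + ((1# - y) * vandermonde n x + v (suc n) * 0# * p n′ (suc n))
      ≈⟨ +-cong (*-congˡ (vandermonde≈1 n (x * q))) (+-congʳ (*-congˡ (vandermonde≈1 n x))) ⟩
    y * 1# + ((1# - y) * 1# + v (suc n) * 0# * p n′ (suc n))
      ≈⟨ solve 3 (λ y a b → y :* :1 :+ ((:1 :- y) :* :1 :+ a :* :0 :* b) := :1) refl _ _ _ ⟩
    1# ∎
    where
    n′ = suc n
    y : Carrier
    y = x * pow q (suc n)
    v : ℕ → Carrier
    v i = pow q (i ℕ.* i) * pow x i
    p : ℕ → ℕ → Carrier
    p m i = qPoch q (x * pow q (suc i)) (m ∸ i)
    t : Carrier → ℕ → Carrier
    t x i = pow q (i ℕ.* i) * pow x i * qBinom q n i * qPoch q (x * pow q (suc i)) (n ∸ i)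
    split : ∀ i → i < suc n → v (suc i) * qBinom q (suc n) (suc i) * p n′ (suc i)
                            ≈ y * t (x * q) i + v (suc i) * qBinom q n (suc i) * p n′ (suc i)
    split i (s≤s i≤n) with ℕₚ.m≤n⇒∃[o]m+o≡n i≤n
    ... | (d , ≡.refl) = begin
      v (suc i) * qBinom q (suc n) (suc i) * P
        ≈⟨ *-congʳ (*-congˡ (qBinom-pascal′ n i d ≡.refl)) ⟩
      pow q (suc i ℕ.* suc i) * (x * pow x i) * (pow q d * b + b′) * P
        ≈⟨ solve 7 (λ a x y d b b′ p → a :* (x :* y) :* (d :* b :+ b′) :* p := a :* d :* (x :* y) :* b :* p :+ a :* (x :* y) :* b′ :* p)
             refl _ x _ _ b b′ P ⟩
      pow q (suc i ℕ.* suc i) * pow q d * (x * pow x i) * b * P + v (suc i) * b′ * P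
        -- Since (i+1)² + (n-i) = i² + i + (n+1), a factor q^(n+1) independent of i splits off and
        -- forms `y`.
        ≈⟨ +-congʳ (*-congʳ (*-congʳ (*-congʳ exponents))) ⟩
      pow q (i ℕ.* i) * pow q i * pow q (suc n) * (x * pow x i) * b * P + v (suc i) * b′ * P
        ≈⟨ +-congʳ (solve 7 (λ a c e x y b p → a :* c :* e :* (x :* y) :* b :* p := x :* e :* (a :* (y :* c) :* b :* p))
             refl _ _ _ x _ b P) ⟩
      y * (pow q (i ℕ.* i) * (pow x i * pow q i) * b * P) + v (suc i) * b′ * P
        ≈⟨ +-congʳ (*-congˡ (*-cong (*-congʳ (*-congˡ (sym (pow-distrib-* x q i)))) (qPoch-cong (n ∸ i) (sym (*-assoc _ _ _))))) ⟩
      y * t (x * q) i + v (suc i) * b′ * P ∎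
      where
      P = p n′ (suc i)
      b = qBinom q n i
      b′ = qBinom q n (suc i)
      exponents : pow q (suc i ℕ.* suc i) * pow q d ≈ pow q (i ℕ.* i) * pow q i * pow q (suc (i ℕ.+ d))
      exponents = trans (pow-*₂ q (suc i ℕ.* suc i) d (arith i d)) (sym (pow-*₃ q (i ℕ.* i) i (suc (i ℕ.+ d)) ≡.refl))
        where
        arith : ∀ i d → suc i ℕ.* suc i ℕ.+ d ≡ i ℕ.* i ℕ.+ i ℕ.+ suc (i ℕ.+ d)
        arith = solve-∀
    peel : ∀ i → i < suc n → v i * qBinom q n i * p n′ i ≈ (1# - y) * t x i
    peel i (s≤s i≤n) = begin
      v i * qBinom q n i * qPoch q (x * pow q (suc i)) (suc n ∸ i)
        ≈⟨ *-congˡ (reflexive (≡.cong (qPoch q (x * pow q (suc i))) (ℕₚ.+-∸-assoc 1 i≤n))) ⟩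
      v i * qBinom q n i * (p n i * (1# - x * pow q (suc i) * pow q (n ∸ i)))
        ≈⟨ *-congˡ (*-congˡ (+-congˡ (-‿cong (trans (*-assoc _ _ _) (*-congˡ (pow-*₂ q (suc i) (n ∸ i) (≡.cong suc (ℕₚ.m+[n∸m]≡n i≤n)))))))) ⟩
      v i * qBinom q n i * (p n i * (1# - y))
        ≈⟨ solve 4 (λ a b c d → a :* b :* (c :* d) := d :* (a :* b :* c)) refl _ _ _ _ ⟩
      (1# - y) * t x i ∎

  -- The q-Fibonacci polynomials.

  -- The recurrence is the one that the defining Pascal recursion yields for the sum of `schurTerm`.
  -- At x q^M = 1 and with q inverted, the sum is that of (-1)^i q^(i(i-1)/2) [M-i, i], which is
  -- known to be zero or a signed power of q according to M modulo 3.
  schur : ℕ → Carrier → Carrier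
  schur 0             x = 1#
  schur 1             x = 1#
  schur (suc (suc M)) x = schur (suc M) (x * q) - x * pow q 2 * schur M (x * pow q 3)

  schur-cong : ∀ M {x y} → x ≈ y → schur M x ≈ schur M y
  schur-cong 0             x≈y = refl
  schur-cong 1             x≈y = refl
  schur-cong (suc (suc M)) x≈y = +-cong (schur-cong (suc M) (*-congʳ x≈y))
    (-‿cong (*-cong (*-congʳ x≈y) (schur-cong M (*-congʳ x≈y))))

  -- For the sum of `schurTerm` this is the effect of the mirrored Pascal recursion. Here it follows
  -- by a two-step induction, because reducing at one end commutes with reducing at the other.
  schur-dual : ∀ M x → schur (2 ℕ.+ M) x ≈ schur (1 ℕ.+ M) x - x * pow q (2 ℕ.+ M) * schur M (x * q)
  schur-dual 0 x = refl
  schur-dual 1 x = solve 2 (λ x q → :1 :- x :* q :* (q :* (q :* :1)) :* :1 :- x :* (q :* (q :* :1)) :* :1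
                                  := :1 :- x :* (q :* (q :* :1)) :* :1 :- x :* (q :* (q :* (q :* :1))) :* :1) refl x q
  schur-dual (suc (suc M)) x = begin
    schur (3 ℕ.+ M) (x * q) - x * pow q 2 * schur (2 ℕ.+ M) (x * pow q 3)
      ≈⟨ +-cong (schur-dual (suc M) (x * q)) (-‿cong (*-congˡ (trans (schur-dual M (x * pow q 3)) (+-congˡ (-‿cong (*-congˡ (schur-cong M swap))))))) ⟩
    a - x * q * (q * (q * (q * u))) * b - x * pow q 2 * (d - x * pow q 3 * (q * (q * u)) * e)
      ≈⟨ solve 7 (λ x q u a b d e →
            a :- x :* q :* (q :* (q :* (q :* u))) :* b :- x :* (q :* (q :* :1)) :* (d :- x :* (q :* (q :* (q :* :1))) :* (q :* (q :* u)) :* e)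
         := a :- x :* (q :* (q :* :1)) :* d :- x :* (q :* (q :* (q :* (q :* u)))) :* (b :- x :* q :* (q :* (q :* :1)) :* e)) refl x q u a b d e ⟩
    schur (3 ℕ.+ M) x - x * pow q (4 ℕ.+ M) * schur (2 ℕ.+ M) (x * q) ∎
    where
    u = pow q M
    a = schur (2 ℕ.+ M) (x * q)
    b = schur (1 ℕ.+ M) (x * q * q)
    d = schur (1 ℕ.+ M) (x * pow q 3)
    e = schur M (x * q * pow q 3)
    swap : x * pow q 3 * q ≈ x * q * pow q 3
    swap = solve 3 (λ x q u → x :* u :* q := x :* q :* u) refl x q (pow q 3)

  -- When x q^{3+M} = 1 the term schur (1 + M) (x q) cancels between schur-dual and the defining recurrence.
  schur-period : ∀ M x → x * pow q (3 ℕ.+ M) ≈ 1# → schur (3 ℕ.+ M) x ≈ - (x * pow q 2) * schur M (x * pow q 3)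
  schur-period M x xq≈1 = begin
    schur (3 ℕ.+ M) x
      ≈⟨ schur-dual (suc M) x ⟩
    schur (2 ℕ.+ M) x - x * pow q (3 ℕ.+ M) * schur (1 ℕ.+ M) (x * q)
      ≈⟨ +-congˡ (-‿cong (trans (*-congʳ xq≈1) (*-identityˡ _))) ⟩
    schur (1 ℕ.+ M) (x * q) - x * pow q 2 * schur M (x * pow q 3) - schur (1 ℕ.+ M) (x * q)
      ≈⟨ solve 3 (λ a b c → a :- b :* c :- a := :- b :* c) refl _ _ _ ⟩
    - (x * pow q 2) * schur M (x * pow q 3) ∎

  -- The hypothesis survives M → M - 3, x → x q³, so `schur-period` applies m times. Its use number
  -- i, counted from 0, contributes -x q^(3i+2), which adds up to the exponent 2m + 3m(m-1)/2.
  schur-iterate : ∀ m M x → x * pow q (m ℕ.* 3 ℕ.+ M) ≈ 1# →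
    schur (m ℕ.* 3 ℕ.+ M) x ≈ pow (- 1#) m * (pow x m * pow q (m ℕ.+ m ℕ.+ 3 ℕ.* triangle m)) * schur M (x * pow q (m ℕ.* 3))
  schur-iterate zero    M x _ = sym (trans (solve 1 (λ a → :1 :* (:1 :* :1) :* a := a) refl _) (schur-cong M (*-identityʳ x)))
  schur-iterate (suc m) M x xq≈1 = begin
    schur (3 ℕ.+ (m ℕ.* 3 ℕ.+ M)) x
      ≈⟨ schur-period (m ℕ.* 3 ℕ.+ M) x xq≈1 ⟩
    - (x * pow q 2) * schur (m ℕ.* 3 ℕ.+ M) (x * pow q 3)
      ≈⟨ *-congˡ (schur-iterate m M (x * pow q 3) (trans (trans (*-assoc _ _ _) (*-congˡ (pow-*₂ q 3 (m ℕ.* 3 ℕ.+ M) ≡.refl))) xq≈1)) ⟩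
    - (x * pow q 2) * (pow (- 1#) m * (pow (x * pow q 3) m * E) * schur M (x * pow q 3 * pow q (m ℕ.* 3)))
      ≈⟨ *-congˡ (*-cong (*-congˡ (*-congʳ (trans (pow-distrib-* x (pow q 3) m) (*-congˡ (pow-pow q 3 m)))))
           (schur-cong M (trans (*-assoc _ _ _) (*-congˡ (pow-*₂ q 3 (m ℕ.* 3) ≡.refl))))) ⟩
    - (x * pow q 2) * (pow (- 1#) m * (pow x m * pow q (m ℕ.* 3) * E) * S)
      ≈⟨ solve 7 (λ x a s y b e S → :- (x :* a) :* (s :* (y :* b :* e) :* S) := :- :1 :* s :* (x :* y :* (a :* b :* e)) :* S) refl x _ _ _ _ _ _ ⟩
    - 1# * pow (- 1#) m * (x * pow x m * (pow q 2 * pow q (m ℕ.* 3) * E)) * S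
      ≈⟨ *-congʳ (*-congˡ (*-congˡ (pow-*₃ q 2 (m ℕ.* 3) (m ℕ.+ m ℕ.+ 3 ℕ.* triangle m) (arith m (triangle m))))) ⟩
    pow (- 1#) (suc m) * (pow x (suc m) * pow q (suc m ℕ.+ suc m ℕ.+ 3 ℕ.* triangle (suc m))) * S ∎
    where
    E = pow q (m ℕ.+ m ℕ.+ 3 ℕ.* triangle m)
    S = schur M (x * pow q (suc m ℕ.* 3))
    arith : ∀ m t → 2 ℕ.+ m ℕ.* 3 ℕ.+ (m ℕ.+ m ℕ.+ 3 ℕ.* t) ≡ suc m ℕ.+ suc m ℕ.+ 3 ℕ.* (m ℕ.+ t)
    arith = solve-∀

  schurTerm : ℕ → Carrier → ℕ → Carrier
  schurTerm M x i = pow (- 1#) i * (pow x i * pow q (i ℕ.* i ℕ.+ triangle (suc i))) * qBinom q (M ∸ i) i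

  -- Truncated subtraction does no harm: for i > M every q-binomial here has upper index 0 and
  -- positive lower index, hence vanishes.
  qBinom-diagonal : ∀ M i → qBinom q (suc M ∸ i) (suc i) ≈ qBinom q (M ∸ i) i + pow q (suc i) * qBinom q (M ∸ i) (suc i)
  qBinom-diagonal M i with i ℕ.≤? M
  ... | yes i≤M = reflexive (≡.cong (λ k → qBinom q k (suc i)) (ℕₚ.+-∸-assoc 1 i≤M))
  ... | no i≰M with i | ℕₚ.≰⇒> i≰M
  ...   | suc i′ | s≤s M≤i′ rewrite ℕₚ.m≤n⇒m∸n≡0 M≤i′ | ℕₚ.m≤n⇒m∸n≡0 (ℕₚ.m≤n⇒m≤1+n M≤i′) =
    solve 1 (λ a → :0 := :0 :+ a :* :0) refl _

  -- Terms with 2i > M vanish, so any `B` with M < 2B will do. A free `B` replaces a floor of M/2,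
  -- and the step M → M - 2, B → B - 1 preserves the bound.
  schur-sum : ∀ M B x → M < B ℕ.+ B → schur M x ≈ sumBelow B (schurTerm M x)
  schur-sum 0 (suc B) x _ = sym (begin
    sumBelow (suc B) (schurTerm 0 x)
      ≈⟨ sum-head B _ ⟩
    schurTerm 0 x 0 + sumBelow B (λ i → schurTerm 0 x (suc i))
      ≈⟨ +-congˡ (sum-zero B (λ i _ → zeroʳ _)) ⟩
    1# * (1# * 1#) * 1# + 0#
      ≈⟨ solve 0 (:1 :* (:1 :* :1) :* :1 :+ :0 := :1) refl ⟩
    1# ∎)
  schur-sum 1 (suc B) x _ = sym (begin
    sumBelow (suc B) (schurTerm 1 x)
      ≈⟨ sum-head B _ ⟩
    schurTerm 1 x 0 + sumBelow B (λ i → schurTerm 1 x (suc i))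
      ≈⟨ +-congˡ (sum-zero B (λ i _ → trans (*-congˡ (reflexive (≡.cong (λ k → qBinom q k (suc i)) (ℕₚ.0∸n≡0 i)))) (zeroʳ _))) ⟩
    1# * (1# * 1#) * 1# + 0#
      ≈⟨ solve 0 (:1 :* (:1 :* :1) :* :1 :+ :0 := :1) refl ⟩
    1# ∎)
  schur-sum (suc (suc M)) (suc B) x (s≤s M+1<B+1+B) = sym (begin
    sumBelow (suc B) (schurTerm (2 ℕ.+ M) x)
      ≈⟨ sum-head B _ ⟩
    schurTerm (2 ℕ.+ M) x 0 + sumBelow B (λ i → schurTerm (2 ℕ.+ M) x (suc i))
      ≈⟨ +-congˡ (trans (sum-cong B split) (sum-+ B _ _)) ⟩
    schurTerm (1 ℕ.+ M) (x * q) 0 + (sumBelow B (λ i → - (x * pow q 2) * schurTerm M (x * pow q 3) i) + sumBelow B (λ i → schurTerm (1 ℕ.+ M) (x * q) (suc i)))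
      ≈⟨ solve 3 (λ a b c → a :+ (b :+ c) := a :+ c :+ b) refl _ _ _ ⟩
    schurTerm (1 ℕ.+ M) (x * q) 0 + sumBelow B (λ i → schurTerm (1 ℕ.+ M) (x * q) (suc i)) + sumBelow B (λ i → - (x * pow q 2) * schurTerm M (x * pow q 3) i)
      ≈⟨ +-cong (sym (sum-head B _)) (sum-*ˡ B _ _) ⟩
    sumBelow (suc B) (schurTerm (1 ℕ.+ M) (x * q)) + - (x * pow q 2) * sumBelow B (schurTerm M (x * pow q 3))
      ≈⟨ +-cong (sym (schur-sum (suc M) (suc B) (x * q) (s≤s (ℕₚ.<⇒≤ M+1<B+1+B)))) (*-congˡ (sym (schur-sum M B (x * pow q 3) M<2B))) ⟩
    schur (suc M) (x * q) + - (x * pow q 2) * schur M (x * pow q 3)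
      ≈⟨ solve 3 (λ a b c → a :+ :- b :* c := a :- b :* c) refl _ _ _ ⟩
    schur (2 ℕ.+ M) x ∎)
    where
    M<2B : M < B ℕ.+ B
    M<2B = ℕₚ.≤-pred (≡.subst (suc M <_) (ℕₚ.+-suc B B) M+1<B+1+B)
    split : ∀ i → schurTerm (2 ℕ.+ M) x (suc i) ≈ - (x * pow q 2) * schurTerm M (x * pow q 3) i + schurTerm (1 ℕ.+ M) (x * q) (suc i)
    split i = begin
      - 1# * s * (x * y * pow q E) * qBinom q (suc M ∸ i) (suc i)
        ≈⟨ *-congˡ (qBinom-diagonal M i) ⟩
      - 1# * s * (x * y * pow q E) * (b + pow q (suc i) * b′)
        ≈⟨ solve 7 (λ s x y E b z b′ → :- :1 :* s :* (x :* y :* E) :* (b :+ z :* b′)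
              := :- x :* (s :* y :* E) :* b :+ :- :1 :* s :* (x :* y :* z :* E) :* b′) refl s x y (pow q E) b (pow q (suc i)) b′ ⟩
      - x * (s * y * pow q E) * b + - 1# * s * (pow x (suc i) * pow q (suc i) * pow q E) * b′
        ≈⟨ +-cong (*-congʳ (*-congˡ (*-congˡ (sym (pow-*₃ q 2 (i ℕ.* 3) (i ℕ.* i ℕ.+ triangle (suc i)) (arith i (triangle i)))))))
                  (*-congʳ (*-congˡ (*-congʳ (sym (pow-distrib-* x q (suc i)))))) ⟩
      - x * (s * y * (pow q 2 * pow q (i ℕ.* 3) * pow q E′)) * b + schurTerm (1 ℕ.+ M) (x * q) (suc i)
        ≈⟨ +-congʳ (solve 7 (λ x s y a c e b → :- x :* (s :* y :* (a :* c :* e)) :* b := :- (x :* a) :* (s :* (y :* c :* e) :* b)) refl x s y _ _ _ b) ⟩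
      - (x * pow q 2) * (s * (y * pow q (i ℕ.* 3) * pow q E′) * b) + schurTerm (1 ℕ.+ M) (x * q) (suc i)
        ≈⟨ +-congʳ (*-congˡ (*-congʳ (*-congˡ (*-congʳ (sym (trans (pow-distrib-* x (pow q 3) i) (*-congˡ (pow-pow q 3 i)))))))) ⟩
      - (x * pow q 2) * schurTerm M (x * pow q 3) i + schurTerm (1 ℕ.+ M) (x * q) (suc i) ∎
      where
      s = pow (- 1#) i
      y = pow x i
      E = suc i ℕ.* suc i ℕ.+ triangle (2 ℕ.+ i)
      E′ = i ℕ.* i ℕ.+ triangle (suc i)
      b = qBinom q (M ∸ i) i
      b′ = qBinom q (M ∸ i) (suc i)
      arith : ∀ i t → 2 ℕ.+ i ℕ.* 3 ℕ.+ (i ℕ.* i ℕ.+ (i ℕ.+ t)) ≡ suc i ℕ.* suc i ℕ.+ (suc i ℕ.+ (i ℕ.+ t))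
      arith = solve-∀

  -- The cubic character sequence and the coefficients α.

  -- χ(k) q^{(k²-1)/3} for the nontrivial character χ modulo 3, split by k = 3t + c.
  cubicRS : ℕ → ℕ → Carrier
  cubicRS t 0 = 0#
  cubicRS t 1 = pow q (3 ℕ.* t ℕ.* t ℕ.+ 2 ℕ.* t)
  cubicRS t _ = - pow q (3 ℕ.* t ℕ.* t ℕ.+ 4 ℕ.* t ℕ.+ 1)

  cubic : ℕ → Carrier
  cubic k = cubicRS (k / 3) (k % 3)

  cubic₀ : ∀ t {k} → k ≡ t ℕ.* 3 → cubic k ≈ 0#
  cubic₀ t ≡.refl = reflexive (≡.cong₂ cubicRS ([c+t*3]/3 0 t) ([c+t*3]%3 0 t))

  cubic₁ : ∀ t {k} → k ≡ 1 ℕ.+ t ℕ.* 3 → cubic k ≈ pow q (3 ℕ.* t ℕ.* t ℕ.+ 2 ℕ.* t)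
  cubic₁ t ≡.refl = reflexive (≡.cong₂ cubicRS ([c+t*3]/3 1 t) ([c+t*3]%3 1 t))

  cubic₂ : ∀ t {k} → k ≡ 2 ℕ.+ t ℕ.* 3 → cubic k ≈ - pow q (3 ℕ.* t ℕ.* t ℕ.+ 4 ℕ.* t ℕ.+ 1)
  cubic₂ t ≡.refl = reflexive (≡.cong₂ cubicRS ([c+t*3]/3 2 t) ([c+t*3]%3 2 t))

  -- The character vanishes at multiples of 3, so the difference has two terms exactly when k is 1
  -- modulo 3.
  alpha≈cubic-difference : ∀ k → alpha q k ≈ cubic (suc k) - cubic k
  alpha≈cubic-difference k with residue₃ k
  ... | 0+3* t = begin
    alpha q (t ℕ.* 3)                             ≡⟨ ≡.cong₂ (alphaRS q) ([c+t*3]/3 0 t) ([c+t*3]%3 0 t) ⟩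
    pow q (3 ℕ.* t ℕ.* t ℕ.+ 2 ℕ.* t)              ≈⟨ solve 1 (λ x → x := x :- :0) refl _ ⟩
    pow q (3 ℕ.* t ℕ.* t ℕ.+ 2 ℕ.* t) - 0#         ≈⟨ sym (+-cong (cubic₁ t ≡.refl) (-‿cong (cubic₀ t ≡.refl))) ⟩
    cubic (suc (t ℕ.* 3)) - cubic (t ℕ.* 3)       ∎
  ... | 1+3* t = begin
    alpha q (1 ℕ.+ t ℕ.* 3)                                 ≡⟨ ≡.cong₂ (alphaRS q) ([c+t*3]/3 1 t) ([c+t*3]%3 1 t) ⟩
    - pow q (3 ℕ.* t ℕ.* t ℕ.+ 4 ℕ.* t ℕ.+ 1) - pow q (3 ℕ.* t ℕ.* t ℕ.+ 2 ℕ.* t)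
      ≈⟨ sym (+-cong (cubic₂ t ≡.refl) (-‿cong (cubic₁ t ≡.refl))) ⟩
    cubic (2 ℕ.+ t ℕ.* 3) - cubic (1 ℕ.+ t ℕ.* 3)           ∎
  ... | 2+3* t = begin
    alpha q (2 ℕ.+ t ℕ.* 3)                                 ≡⟨ ≡.cong₂ (alphaRS q) ([c+t*3]/3 2 t) ([c+t*3]%3 2 t) ⟩
    pow q (3 ℕ.* suc t ℕ.* suc t ∸ 2 ℕ.* suc t)             ≡⟨ ≡.cong (pow q) (≡.trans (≡.cong (_∸ 2 ℕ.* suc t) (arith t)) (ℕₚ.m+n∸n≡m (3 ℕ.* t ℕ.* t ℕ.+ 4 ℕ.* t ℕ.+ 1) (2 ℕ.* suc t))) ⟩
    pow q (3 ℕ.* t ℕ.* t ℕ.+ 4 ℕ.* t ℕ.+ 1)                 ≈⟨ solve 1 (λ x → x := :0 :- :- x) refl _ ⟩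
    0# - - pow q (3 ℕ.* t ℕ.* t ℕ.+ 4 ℕ.* t ℕ.+ 1)          ≈⟨ sym (+-cong (cubic₀ (suc t) ≡.refl) (-‿cong (cubic₂ t ≡.refl))) ⟩
    cubic (suc t ℕ.* 3) - cubic (2 ℕ.+ t ℕ.* 3)             ∎
    where
    arith : ∀ t → 3 ℕ.* suc t ℕ.* suc t ≡ 3 ℕ.* t ℕ.* t ℕ.+ 4 ℕ.* t ℕ.+ 1 ℕ.+ 2 ℕ.* suc t
    arith = solve-∀

-- Arithmetic at a primitive root of unity.

module RootOfUnity {c ℓ : Level} (R : CommutativeRing c ℓ)
  (1≉0 : PowersAndSums.Nontrivial R) (integral : PowersAndSums.NoZeroDivisors R)
  (N : ℕ) (1≤N : 1 ≤ N) (q : CommutativeRing.Carrier R) (primitive-root : PowersAndSums.PrimitiveRoot R N q) where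

  open CommutativeRing R
  open WithRing R
  open IntegerCoefficients R
  open PowersAndSums R
  open QBinomials R q
  open SetoidReasoning setoid

  q^N≈1 : pow q N ≈ 1#
  q^N≈1 = proj₁ primitive-root

  x-y≈0⇒x≈y : ∀ {x y} → x - y ≈ 0# → x ≈ y
  x-y≈0⇒x≈y {x} {y} eq = begin
    x            ≈⟨ solve 2 (λ x y → x := x :- y :+ y) refl x y ⟩
    x - y + y    ≈⟨ +-congʳ eq ⟩
    0# + y       ≈⟨ +-identityˡ y ⟩
    y            ∎

  *-nonzero : ∀ {x y} → ¬ (x ≈ 0#) → ¬ (y ≈ 0#) → ¬ (x * y ≈ 0#)
  *-nonzero x≉0 y≉0 xy≈0 with integral _ _ xy≈0
  ... | inj₁ x≈0 = x≉0 x≈0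
  ... | inj₂ y≈0 = y≉0 y≈0

  *-cancelˡ : ∀ {x y z} → ¬ (x ≈ 0#) → x * y ≈ x * z → y ≈ z
  *-cancelˡ {x} {y} {z} x≉0 xy≈xz with integral x (y - z) x[y-z]≈0
    where
    x[y-z]≈0 : x * (y - z) ≈ 0#
    x[y-z]≈0 = begin
      x * (y - z)      ≈⟨ solve 3 (λ x y z → x :* (y :- z) := x :* y :- x :* z) refl x y z ⟩
      x * y - x * z    ≈⟨ +-congʳ xy≈xz ⟩
      x * z - x * z    ≈⟨ -‿inverseʳ _ ⟩
      0#               ∎
  ... | inj₁ x≈0   = ⊥-elim (x≉0 x≈0)
  ... | inj₂ y-z≈0 = x-y≈0⇒x≈y y-z≈0

  pow-N* : ∀ k → pow q (k ℕ.* N) ≈ 1#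
  pow-N* k = begin
    pow q (k ℕ.* N)    ≈⟨ sym (pow-pow q N k) ⟩
    pow (pow q N) k    ≈⟨ pow-cong k q^N≈1 ⟩
    pow 1# k           ≈⟨ pow-1# k ⟩
    1#                 ∎

  -- Exponents are compared modulo N with explicit multiples on both sides, as no subtraction is
  -- available. The separate `n` lets N be written as a polynomial in other variables, so that the
  -- comparison becomes a semiring identity.
  pow-mod : ∀ {n a b} → n ≡ N → ∀ x y → a ℕ.+ x ℕ.* n ≡ b ℕ.+ y ℕ.* n → pow q a ≈ pow q b
  pow-mod {_} {a} {b} ≡.refl x y eq = begin
    pow q a                       ≈⟨ sym (*-identityʳ _) ⟩
    pow q a * 1#                  ≈⟨ *-congˡ (sym (pow-N* x)) ⟩
    pow q a * pow q (x ℕ.* N)     ≈⟨ pow-*₂ q a (x ℕ.* N) eq ⟩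
    pow q (b ℕ.+ y ℕ.* N)         ≈⟨ pow-+ q b (y ℕ.* N) ⟩
    pow q b * pow q (y ℕ.* N)     ≈⟨ *-congˡ (pow-N* y) ⟩
    pow q b * 1#                  ≈⟨ *-identityʳ _ ⟩
    pow q b                       ∎

  q≉0 : ¬ (q ≈ 0#)
  q≉0 q≈0 with ℕₚ.m≤n⇒∃[o]m+o≡n 1≤N
  ... | (n , ≡.refl) = 1≉0 (trans (sym q^N≈1) (trans (*-congʳ q≈0) (zeroˡ _)))

  pow-nonzero : ∀ k → ¬ (pow q k ≈ 0#)
  pow-nonzero zero    = 1≉0
  pow-nonzero (suc k) = *-nonzero q≉0 (pow-nonzero k)

  sign-nonzero : ∀ k → ¬ (pow (- 1#) k ≈ 0#)
  sign-nonzero k s≈0 = 1≉0 (trans (sym (sign² k)) (trans (*-congʳ s≈0) (zeroˡ _)))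

  1-q^-nonzero : ∀ j {x} → pow q j ≈ x → 1 ≤ j → j < N → ¬ (1# - x ≈ 0#)
  1-q^-nonzero j q^j≈x 1≤j j<N 1-x≈0 = proj₂ primitive-root j 1≤j j<N (trans q^j≈x (sym (x-y≈0⇒x≈y 1-x≈0)))

  qPoch-nonzero : ∀ b n → b ℕ.+ n < N → ¬ (qPoch q (pow q (suc b)) n ≈ 0#)
  qPoch-nonzero b zero    _   = 1≉0
  qPoch-nonzero b (suc n) b+n<N = *-nonzero (qPoch-nonzero b n (ℕₚ.<-trans (ℕₚ.+-monoʳ-< b ℕₚ.≤-refl) b+n<N))
    (1-q^-nonzero (suc b ℕ.+ n) (pow-+ q (suc b) n) (s≤s z≤n) (≡.subst (_< N) (ℕₚ.+-suc b n) b+n<N))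

  qFactorial-nonzero : ∀ n → n < N → ¬ (qFactorial n ≈ 0#)
  qFactorial-nonzero n n<N eq = qPoch-nonzero 0 n n<N (trans (qPoch-cong n (*-identityʳ q)) eq)

  -- The Bailey kernel without denominators.

  -- This is [2n, n-r] (1 - q^{2r+1})/(1 - q^{n+r+1}); with the lower index n + r it vanishes for r > n.
  ballot : ℕ → ℕ → Carrier
  ballot n r = qBinom q (n ℕ.+ n) (n ℕ.+ r) - pow q (suc (r ℕ.+ r)) * qBinom q (n ℕ.+ n) (suc (n ℕ.+ r))

  ballot-zero : ∀ {n r} → n < r → ballot n r ≈ 0#
  ballot-zero {n} {r} n<r = begin
    ballot n r ≈⟨ +-cong (qBinom-zero (ℕₚ.+-monoʳ-< n n<r)) (-‿cong (*-congˡ (qBinom-zero (ℕₚ.m<n⇒m<1+n (ℕₚ.+-monoʳ-< n n<r))))) ⟩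
    0# - pow q (suc (r ℕ.+ r)) * 0# ≈⟨ solve 1 (λ a → :0 :- a :* :0 := :0) refl _ ⟩
    0# ∎

  ballot-diag : ∀ n → ballot n n ≈ 1#
  ballot-diag n = begin
    ballot n n ≈⟨ +-cong (qBinom-diag (n ℕ.+ n)) (-‿cong (*-congˡ (qBinom-zero {n ℕ.+ n} ℕₚ.≤-refl))) ⟩
    1# - pow q (suc (n ℕ.+ n)) * 0# ≈⟨ solve 1 (λ a → :1 :- a :* :0 := :1) refl _ ⟩
    1# ∎

  -- For n = r + d this is (q)_(n-r) (q)_(n+r+1) / (1 - q^(2r+1)). The factor 1 - q^(2r+1) is left
  -- out of the product rather than divided off, because for d = 0 the number 2r + 1 may equal N,
  -- and the product must remain nonzero.
  ballotDenominator : ℕ → ℕ → Carrier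
  ballotDenominator r d = qFactorial (r ℕ.+ r) * (qFactorial d * qPoch q (pow q (2 ℕ.+ (r ℕ.+ r))) d)

  -- The two q-binomials combine by (1 - q^(n+r+1)) - q^(2r+1) (1 - q^(n-r)) = 1 - q^(2r+1). This
  -- factor can be cancelled for d > 0, where 2r + 1 < 2n < N; hence the separate case d = 0.
  ballot-qFactorial : ∀ n r d → n ≡ r ℕ.+ d → n ℕ.+ n < N → ballot n r * ballotDenominator r d ≈ qFactorial (n ℕ.+ n)
  ballot-qFactorial n r zero eq _ with ≡.trans eq (ℕₚ.+-identityʳ r)
  ... | ≡.refl = trans (*-congʳ (ballot-diag n)) (solve 1 (λ a → :1 :* (a :* (:1 :* :1)) := a) refl _)
  ballot-qFactorial n r (suc e) ≡.refl 2n<N = *-cancelˡ (1-q^-nonzero (suc (r ℕ.+ r)) refl (s≤s z≤n) 2r+1<N) (begin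
    (1# - z) * ((B₁ - z * B₂) * (f * (g * (1# - q * pow q e) * (p * (1# - w * pow q e)))))
      ≈⟨ solve 9 (λ B₁ B₂ f g p z q u w → (:1 :- z) :* ((B₁ :- z :* B₂) :* (f :* (g :* (:1 :- q :* u) :* (p :* (:1 :- w :* u)))))
          := (:1 :- w :* u) :* (B₁ :* (f :* (:1 :- z) :* p :* (g :* (:1 :- q :* u)))) :- z :* (:1 :- q :* u) :* (B₂ :* (f :* (:1 :- z) :* p :* (:1 :- w :* u) :* g)))
          refl B₁ B₂ f g p z q (pow q e) w ⟩
    (1# - w * pow q e) * (B₁ * (f * (1# - z) * p * (g * (1# - q * pow q e))))
      - z * (1# - q * pow q e) * (B₂ * (f * (1# - z) * p * (1# - w * pow q e) * g))
      ≈⟨ +-cong (*-congˡ first) (-‿cong (*-congˡ second)) ⟩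
    (1# - w * pow q e) * F - z * (1# - q * pow q e) * F
      ≈⟨ solve 5 (λ z w u q F → (:1 :- q :* z :* u) :* F :- z :* (:1 :- q :* u) :* F := (:1 :- z) :* F) refl z w (pow q e) q F ⟩
    (1# - z) * F ∎)
    where
    2r+1<N : suc (r ℕ.+ r) < N
    2r+1<N = ℕₚ.≤-trans (ℕₚ.≤-trans (ℕₚ.m≤m+n _ (e ℕ.+ suc e)) (ℕₚ.≤-reflexive (arith r e))) 2n<N
      where
      arith : ∀ r e → 2 ℕ.+ (r ℕ.+ r) ℕ.+ (e ℕ.+ suc e) ≡ suc (r ℕ.+ suc e ℕ.+ (r ℕ.+ suc e))
      arith = solve-∀
    z = pow q (suc (r ℕ.+ r))
    w = pow q (2 ℕ.+ (r ℕ.+ r))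
    B₁ = qBinom q (n ℕ.+ n) (n ℕ.+ r)
    B₂ = qBinom q (n ℕ.+ n) (suc (n ℕ.+ r))
    f = qFactorial (r ℕ.+ r)
    g = qFactorial e
    p = qPoch q (pow q (2 ℕ.+ (r ℕ.+ r))) e
    F = qFactorial (n ℕ.+ n)
    n+r : suc (r ℕ.+ r) ℕ.+ e ≡ n ℕ.+ r
    n+r = arith r e
      where
      arith : ∀ r e → suc (r ℕ.+ r) ℕ.+ e ≡ r ℕ.+ suc e ℕ.+ r
      arith = solve-∀
    qFactorial-n+r : f * (1# - z) * p ≈ qFactorial (n ℕ.+ r)
    qFactorial-n+r = trans (sym (qFactorial-+ (suc (r ℕ.+ r)) e)) (reflexive (≡.cong qFactorial n+r))
    first : B₁ * (f * (1# - z) * p * (g * (1# - q * pow q e))) ≈ F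
    first = trans (*-congˡ (*-congʳ qFactorial-n+r)) (qBinom-qFactorial (n ℕ.+ n) (n ℕ.+ r) (suc e) (≡.sym (ℕₚ.+-assoc n r (suc e))))
    second : B₂ * (f * (1# - z) * p * (1# - w * pow q e) * g) ≈ F
    second = trans
      (*-congˡ (*-congʳ (*-cong qFactorial-n+r (+-congˡ (-‿cong (trans (sym (pow-+ q (2 ℕ.+ (r ℕ.+ r)) e)) (pow-≡ q (≡.cong suc n+r))))))))
      (qBinom-qFactorial (n ℕ.+ n) (suc (n ℕ.+ r)) e (arith n r e))
      where
      arith : ∀ n r e → n ℕ.+ (r ℕ.+ suc e) ≡ suc (n ℕ.+ r) ℕ.+ e
      arith = solve-∀

  ballotDenominator-nonzero : ∀ r d → r ℕ.+ d ℕ.+ (r ℕ.+ d) < N → ¬ (ballotDenominator r d ≈ 0#)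
  ballotDenominator-nonzero r d 2n<N = *-nonzero (qFactorial-nonzero (r ℕ.+ r) (bound (r ℕ.+ r) (d ℕ.+ d) (arith₁ r d)))
    (*-nonzero (qFactorial-nonzero d (bound d (r ℕ.+ (r ℕ.+ d)) (arith₂ r d))) (tail d 2n<N))
    where
    bound : ∀ a b → a ℕ.+ b ≡ r ℕ.+ d ℕ.+ (r ℕ.+ d) → a < N
    bound a b eq = ℕₚ.≤-<-trans (ℕₚ.≤-trans (ℕₚ.m≤m+n a b) (ℕₚ.≤-reflexive eq)) 2n<N
    arith₁ : ∀ r d → r ℕ.+ r ℕ.+ (d ℕ.+ d) ≡ r ℕ.+ d ℕ.+ (r ℕ.+ d)
    arith₁ = solve-∀
    arith₂ : ∀ r d → d ℕ.+ (r ℕ.+ (r ℕ.+ d)) ≡ r ℕ.+ d ℕ.+ (r ℕ.+ d)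
    arith₂ = solve-∀
    tail : ∀ d → r ℕ.+ d ℕ.+ (r ℕ.+ d) < N → ¬ (qPoch q (pow q (2 ℕ.+ (r ℕ.+ r))) d ≈ 0#)
    tail zero    _ = 1≉0
    tail (suc e) 2n<N = qPoch-nonzero (suc (r ℕ.+ r)) (suc e) (ℕₚ.≤-<-trans (ℕₚ.≤-trans (ℕₚ.m≤m+n _ e) (ℕₚ.≤-reflexive (arith r e))) 2n<N)
      where
      arith : ∀ r e → suc (r ℕ.+ r) ℕ.+ suc e ℕ.+ e ≡ r ℕ.+ suc e ℕ.+ (r ℕ.+ suc e)
      arith = solve-∀

  -- The Bailey step.

  -- This is (q)_(2n) / ((q)_(2m) (q)_(n-m)): the factor 1/(q)_(n-m) of Bailey's lemma, rescaled
  -- because `ballot` carries a numerator (q)_(2n).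
  stepKernel : ℕ → ℕ → Carrier
  stepKernel n m = qBinom q (n ℕ.+ n) (m ℕ.+ m) * qPoch q (pow q (suc (n ∸ m))) (n ∸ m)

  -- The summation behind Bailey's lemma. Put m = r + i and l = n - r; after multiplication by
  -- `ballotDenominator r l` the sum becomes `vandermonde l x` at x = q^(2r+1), up to a factor
  -- independent of i.
  stepKernel-ballot : ∀ n r → r ≤ n → n ℕ.+ n < N →
    sumBelow (suc n) (λ m → pow q (m ℕ.* suc m) * stepKernel n m * ballot m r) ≈ pow q (r ℕ.* suc r) * ballot n r
  stepKernel-ballot n r r≤n 2n<N with ℕₚ.m≤n⇒∃[o]m+o≡n r≤n
  ... | (l , ≡.refl) = *-cancelˡ (ballotDenominator-nonzero r l 2n<N) (begin
    D * sumBelow (suc (r ℕ.+ l)) t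
      ≈⟨ *-congˡ (reflexive (≡.cong (λ k → sumBelow k t) (≡.sym (ℕₚ.+-suc r l)))) ⟩
    D * sumBelow (r ℕ.+ suc l) t
      ≈⟨ *-congˡ (trans (sum-split r (suc l) t) (+-congʳ (sum-zero r (λ m m<r → trans (*-congˡ (ballot-zero m<r)) (zeroʳ _))))) ⟩
    D * (0# + sumBelow (suc l) (λ i → t (r ℕ.+ i)))
      ≈⟨ trans (*-congˡ (+-identityˡ _)) (sym (sum-*ˡ (suc l) D _)) ⟩
    sumBelow (suc l) (λ i → D * t (r ℕ.+ i))
      ≈⟨ sum-cong< (suc l) term ⟩
    sumBelow (suc l) (λ i → F * pow q (r ℕ.* suc r) * v i)
      ≈⟨ trans (sum-*ˡ (suc l) _ v) (*-congˡ (vandermonde≈1 l x)) ⟩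
    F * pow q (r ℕ.* suc r) * 1#
      ≈⟨ *-congʳ (*-congʳ (sym (ballot-qFactorial n r l ≡.refl 2n<N))) ⟩
    ballot n r * D * pow q (r ℕ.* suc r) * 1#
      ≈⟨ solve 3 (λ b d p → b :* d :* p :* :1 := d :* (p :* b)) refl _ D _ ⟩
    D * (pow q (r ℕ.* suc r) * ballot n r) ∎)
    where
    D = ballotDenominator r l
    F = qFactorial (n ℕ.+ n)
    x = pow q (suc (r ℕ.+ r))
    w = pow q (2 ℕ.+ (r ℕ.+ r))
    t v : ℕ → Carrier
    t m = pow q (m ℕ.* suc m) * stepKernel n m * ballot m r
    v i = pow q (i ℕ.* i) * pow x i * qBinom q l i * qPoch q (x * pow q (suc i)) (l ∸ i)
    term : ∀ i → i < suc l → D * t (r ℕ.+ i) ≈ F * pow q (r ℕ.* suc r) * v i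
    term i (s≤s i≤l) with ℕₚ.m≤n⇒∃[o]m+o≡n i≤l
    ... | (e , ≡.refl) = begin
      f * (qFactorial (i ℕ.+ e) * qPoch q w (i ℕ.+ e)) * (pow q (m ℕ.* suc m) * (B * qPoch q (pow q (suc (n ∸ m))) (n ∸ m)) * ballot m r)
        ≈⟨ *-cong (*-congˡ (*-cong (sym (qBinom-qFactorial (i ℕ.+ e) i e ≡.refl)) (trans (qPoch-+ w i e) (*-congˡ (qPoch-cong e wq^i)))))
             (*-congʳ (*-cong exponents (*-congˡ (reflexive (≡.cong (λ k → qPoch q (pow q (suc k)) k) n∸m≡e))))) ⟩
      f * (b * (gi * ge) * (qPoch q w i * P)) * (qr * (qi * pow x i) * (B * p) * ballot m r)
        ≈⟨ solve 12 (λ f b gi ge pw P qr qi xi B p L → f :* (b :* (gi :* ge) :* (pw :* P)) :* (qr :* (qi :* xi) :* (B :* p) :* L)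
               := B :* (L :* (f :* (gi :* pw)) :* (ge :* p)) :* qr :* (qi :* xi :* b :* P)) refl
             f b gi ge (qPoch q w i) P qr qi (pow x i) B p (ballot m r) ⟩
      B * (ballot m r * (f * (gi * qPoch q w i)) * (ge * p)) * qr * (qi * pow x i * b * P)
        ≈⟨ *-congʳ (*-congʳ (*-congˡ (*-cong (ballot-qFactorial m r i ≡.refl 2m<N) (sym (qFactorial-+ e e))))) ⟩
      B * (qFactorial (m ℕ.+ m) * qFactorial (e ℕ.+ e)) * qr * (qi * pow x i * b * P)
        ≈⟨ *-congʳ (*-congʳ (qBinom-qFactorial (n ℕ.+ n) (m ℕ.+ m) (e ℕ.+ e) (arith₃ r i e))) ⟩
      F * qr * (qi * pow x i * b * P)
        ≈⟨ *-congˡ (*-congˡ (reflexive (≡.cong (qPoch q (x * pow q (suc i))) (≡.sym (ℕₚ.m+n∸m≡n i e))))) ⟩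
      F * qr * v i ∎
      where
      m = r ℕ.+ i
      f = qFactorial (r ℕ.+ r)
      gi = qFactorial i
      ge = qFactorial e
      b = qBinom q (i ℕ.+ e) i
      B = qBinom q (n ℕ.+ n) (m ℕ.+ m)
      P = qPoch q (x * pow q (suc i)) e
      p = qPoch q (pow q (suc e)) e
      qr = pow q (r ℕ.* suc r)
      qi = pow q (i ℕ.* i)
      arith₃ : ∀ r i e → r ℕ.+ (i ℕ.+ e) ℕ.+ (r ℕ.+ (i ℕ.+ e)) ≡ r ℕ.+ i ℕ.+ (r ℕ.+ i) ℕ.+ (e ℕ.+ e)
      arith₃ = solve-∀
      2m<N : m ℕ.+ m < N
      2m<N = ℕₚ.≤-<-trans (ℕₚ.≤-trans (ℕₚ.m≤m+n _ (e ℕ.+ e)) (ℕₚ.≤-reflexive (≡.sym (arith₃ r i e)))) 2n<N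
      n∸m≡e : n ∸ m ≡ e
      n∸m≡e = ≡.trans (≡.cong (_∸ m) (≡.sym (ℕₚ.+-assoc r i e))) (ℕₚ.m+n∸m≡n m e)
      wq^i : w * pow q i ≈ x * pow q (suc i)
      wq^i = solve 3 (λ q x y → q :* x :* y := x :* (q :* y)) refl q x (pow q i)
      exponents : pow q (m ℕ.* suc m) ≈ qr * (qi * pow x i)
      exponents = begin
        pow q (m ℕ.* suc m) ≈⟨ sym (pow-*₂ q (r ℕ.* suc r) (i ℕ.* i ℕ.+ i ℕ.* suc (r ℕ.+ r)) (arith r i)) ⟩
        qr * pow q (i ℕ.* i ℕ.+ i ℕ.* suc (r ℕ.+ r)) ≈⟨ *-congˡ (pow-+ q (i ℕ.* i) _) ⟩
        qr * (qi * pow q (i ℕ.* suc (r ℕ.+ r))) ≈⟨ *-congˡ (*-congˡ (sym (pow-pow q (suc (r ℕ.+ r)) i))) ⟩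
        qr * (qi * pow x i) ∎
        where
        arith : ∀ r i → r ℕ.* suc r ℕ.+ (i ℕ.* i ℕ.+ i ℕ.* suc (r ℕ.+ r)) ≡ (r ℕ.+ i) ℕ.* suc (r ℕ.+ i)
        arith = solve-∀

  -- Both sides become (q)_(2n) when multiplied by (q)_m (q)_(n-m). It moves the prefactor of a
  -- Bailey relation from index n to index m.
  qPoch-qBinom : ∀ n m → m ≤ n → n ℕ.+ n < N →
    qPoch q (pow q (suc n)) n * qBinom q n m ≈ stepKernel n m * qPoch q (pow q (suc m)) m
  qPoch-qBinom n m m≤n 2n<N with ℕₚ.m≤n⇒∃[o]m+o≡n m≤n
  ... | (d , ≡.refl) = *-cancelˡ (*-nonzero (qFactorial-nonzero m (below (ℕₚ.m≤m+n m d))) (qFactorial-nonzero d (below (ℕₚ.m≤n+m d m)))) (begin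
    qFactorial m * qFactorial d * (qPoch q (pow q (suc n)) n * qBinom q n m)
      ≈⟨ solve 3 (λ f p b → f :* (p :* b) := b :* f :* p) refl _ _ _ ⟩
    qBinom q n m * (qFactorial m * qFactorial d) * qPoch q (pow q (suc n)) n
      ≈⟨ trans (*-congʳ (qBinom-qFactorial n m d ≡.refl)) (sym (qFactorial-+ n n)) ⟩
    qFactorial (n ℕ.+ n)
      ≈⟨ sym (qBinom-qFactorial (n ℕ.+ n) (m ℕ.+ m) (d ℕ.+ d) (arith m d)) ⟩
    B * (qFactorial (m ℕ.+ m) * qFactorial (d ℕ.+ d))
      ≈⟨ *-congˡ (*-cong (qFactorial-+ m m) (qFactorial-+ d d)) ⟩
    B * (qFactorial m * qPoch q (pow q (suc m)) m * (qFactorial d * qPoch q (pow q (suc d)) d))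
      ≈⟨ *-congˡ (*-congˡ (*-congˡ (reflexive (≡.cong (λ k → qPoch q (pow q (suc k)) k) (≡.sym (ℕₚ.m+n∸m≡n m d)))))) ⟩
    B * (qFactorial m * qPoch q (pow q (suc m)) m * (qFactorial d * qPoch q (pow q (suc (n ∸ m))) (n ∸ m)))
      ≈⟨ solve 5 (λ B f p g r → B :* (f :* p :* (g :* r)) := f :* g :* (B :* r :* p)) refl _ _ _ _ _ ⟩
    qFactorial m * qFactorial d * (stepKernel n m * qPoch q (pow q (suc m)) m) ∎)
    where
    B = qBinom q (n ℕ.+ n) (m ℕ.+ m)
    below : ∀ {k} → k ≤ n → k < N
    below k≤n = ℕₚ.≤-<-trans (ℕₚ.≤-trans k≤n (ℕₚ.m≤m+n n n)) 2n<N
    arith : ∀ m d → m ℕ.+ d ℕ.+ (m ℕ.+ d) ≡ m ℕ.+ m ℕ.+ (d ℕ.+ d)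
    arith = solve-∀

  -- The usual Bailey pair relative to a = q is (α_r (1 - q^{2r+1})/(1 - q), β_n/(q)_n);
  -- the defining relation is cleared of denominators.
  BaileyPair : (ℕ → Carrier) → (ℕ → Carrier) → Set ℓ
  BaileyPair α β = ∀ n → n ℕ.+ n < N →
    qPoch q (pow q (suc n)) n * β n ≈ sumBelow (suc n) (λ r → α r * ballot n r)

  -- Bailey's lemma at a = q with both free parameters sent to infinity; the proof expands β and
  -- interchanges the two sums.
  baileyStep : ∀ {α β} → BaileyPair α β →
    BaileyPair (λ r → pow q (r ℕ.* suc r) * α r) (λ n → sumTo n (λ m → pow q (m ℕ.* suc m) * qBinom q n m * β m))
  baileyStep {α} {β} pair n 2n<N = begin
    P n * sumTo n (λ m → pow q (m ℕ.* suc m) * qBinom q n m * β m)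
      ≈⟨ trans (*-congˡ (sumTo≈sumBelow n _)) (sym (sum-*ˡ (suc n) (P n) _)) ⟩
    sumBelow (suc n) (λ m → P n * (pow q (m ℕ.* suc m) * qBinom q n m * β m))
      ≈⟨ sum-cong< (suc n) row ⟩
    sumBelow (suc n) (λ m → sumBelow (suc n) (λ r → α r * (pow q (m ℕ.* suc m) * stepKernel n m * ballot m r)))
      ≈⟨ sum-swap (suc n) (suc n) _ ⟩
    sumBelow (suc n) (λ r → sumBelow (suc n) (λ m → α r * (pow q (m ℕ.* suc m) * stepKernel n m * ballot m r)))
      ≈⟨ sum-cong< (suc n) column ⟩
    sumBelow (suc n) (λ r → pow q (r ℕ.* suc r) * α r * ballot n r) ∎
    where
    P : ℕ → Carrier
    P n = qPoch q (pow q (suc n)) n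
    row : ∀ m → m < suc n → P n * (pow q (m ℕ.* suc m) * qBinom q n m * β m)
                           ≈ sumBelow (suc n) (λ r → α r * (pow q (m ℕ.* suc m) * stepKernel n m * ballot m r))
    row m (s≤s m≤n) = begin
      P n * (pow q (m ℕ.* suc m) * qBinom q n m * β m)
        ≈⟨ solve 4 (λ p e b β → p :* (e :* b :* β) := e :* (p :* b) :* β) refl _ _ _ _ ⟩
      pow q (m ℕ.* suc m) * (P n * qBinom q n m) * β m
        ≈⟨ *-congʳ (*-congˡ (qPoch-qBinom n m m≤n 2n<N)) ⟩
      pow q (m ℕ.* suc m) * (stepKernel n m * P m) * β m
        ≈⟨ solve 4 (λ e k p β → e :* (k :* p) :* β := e :* k :* (p :* β)) refl _ _ _ _ ⟩
      pow q (m ℕ.* suc m) * stepKernel n m * (P m * β m)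
        ≈⟨ *-congˡ (pair m (ℕₚ.≤-<-trans (ℕₚ.+-mono-≤ m≤n m≤n) 2n<N)) ⟩
      pow q (m ℕ.* suc m) * stepKernel n m * sumBelow (suc m) (λ r → α r * ballot m r)
        ≈⟨ *-congˡ (sym (sum-extend _ (s≤s m≤n) (λ r m<r _ → trans (*-congˡ (ballot-zero m<r)) (zeroʳ _)))) ⟩
      pow q (m ℕ.* suc m) * stepKernel n m * sumBelow (suc n) (λ r → α r * ballot m r)
        ≈⟨ sym (sum-*ˡ (suc n) _ _) ⟩
      sumBelow (suc n) (λ r → pow q (m ℕ.* suc m) * stepKernel n m * (α r * ballot m r))
        ≈⟨ sum-cong (suc n) (λ r → solve 3 (λ k a b → k :* (a :* b) := a :* (k :* b)) refl _ _ _) ⟩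
      sumBelow (suc n) (λ r → α r * (pow q (m ℕ.* suc m) * stepKernel n m * ballot m r)) ∎
    column : ∀ r → r < suc n → sumBelow (suc n) (λ m → α r * (pow q (m ℕ.* suc m) * stepKernel n m * ballot m r))
                              ≈ pow q (r ℕ.* suc r) * α r * ballot n r
    column r (s≤s r≤n) = trans (sum-*ˡ (suc n) (α r) _) (trans (*-congˡ (stepKernel-ballot n r r≤n 2n<N))
      (solve 3 (λ a e b → a :* (e :* b) := e :* a :* b) refl _ _ _))

  -- The unit Bailey pair and its iterates.

  -- `p` counts the Bailey steps already applied, each of which contributes q^(r²+r).
  unitα : ℕ → ℕ → Carrier
  unitα p r = pow (- 1#) r * pow q (triangle r ℕ.+ p ℕ.* (r ℕ.* suc r))

  unitβ : ℕ → Carrier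
  unitβ zero    = 1#
  unitβ (suc n) = 0#

  -- With x q^{n-1} = 1 the sum alternating (2n) x is zero; its terms k ≥ n and k < n
  -- are, up to a common unit, the contributions of the two q-binomials in ballot.
  unitPair : BaileyPair (unitα 0) unitβ
  unitPair zero _ = solve 1 (λ q → :1 :* :1 := :0 :+ :1 :* :1 :* (:1 :- q :* :0)) refl (pow q 1)
  unitPair (suc n′) 2n<N with ℕₚ.m≤n⇒∃[o]m+o≡n (ℕₚ.<⇒≤ (ℕₚ.<-trans (s≤s (ℕₚ.m≤m+n n′ (suc n′))) 2n<N))
  -- Here `e` = N - (n-1), so that q^e is the inverse of q^(n-1) with a natural exponent.
  ... | (e , n′+e≡N) = trans (zeroʳ _) (sym (begin
    sumBelow (suc n) (λ r → unitα 0 r * ballot n r)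
      ≈⟨ trans (sum-cong (suc n) expand) (sum-+ (suc n) a b) ⟩
    sumBelow (suc n) a + (sumBelow n b + b n)
      ≈⟨ +-cong (sum-head n a) (+-congˡ (trans (*-congˡ (qBinom-zero {n ℕ.+ n} (s≤s ℕₚ.≤-refl))) (zeroʳ _))) ⟩
    a 0 + sumBelow n (λ s → a (suc s)) + (sumBelow n b + 0#)
      -- `a 0` is also `b′ 0`, as `triangle 0` and `triangle 1` are both 0; it supplies the initial
      -- term that the shifted `b` lacks.
      ≈⟨ solve 3 (λ a s b → a :+ s :+ (b :+ :0) := s :+ (a :+ b)) refl _ _ _ ⟩
    sumBelow n (λ s → a (suc s)) + (b′ 0 + sumBelow n b)
      ≈⟨ +-congˡ (+-congˡ (sum-cong n (λ r → *-congˡ (reflexive (≡.cong (qBinom q (n ℕ.+ n)) (≡.sym (ℕₚ.+-suc n r))))))) ⟩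
    sumBelow n (λ s → a (suc s)) + (b′ 0 + sumBelow n (λ r → b′ (suc r)))
      ≈⟨ +-congˡ (sym (sum-head n b′)) ⟩
    sumBelow n (λ s → a (suc s)) + sumBelow (suc n) b′
      ≈⟨ *-cancelˡ (*-nonzero (sign-nonzero n) (pow-nonzero (triangle n ℕ.+ n ℕ.* e))) (trans (sym scaled) (trans alternating≈0 (sym (zeroʳ _)))) ⟩
    0# ∎))
    where
    n = suc n′
    κ : Carrier
    κ = pow (- 1#) n * pow q (triangle n ℕ.+ n ℕ.* e)
    a b b′ t : ℕ → Carrier
    a r = pow (- 1#) r * pow q (triangle r) * qBinom q (n ℕ.+ n) (n ℕ.+ r)
    b r = pow (- 1#) (suc r) * pow q (triangle (2 ℕ.+ r)) * qBinom q (n ℕ.+ n) (suc (n ℕ.+ r))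
    b′ r = pow (- 1#) r * pow q (triangle (suc r)) * qBinom q (n ℕ.+ n) (n ℕ.+ r)
    t k = pow (- 1#) k * pow q (triangle k) * pow (pow q e) k * qBinom q (n ℕ.+ n) k
    expand : ∀ r → unitα 0 r * ballot n r ≈ a r + b r
    expand r = begin
      pow (- 1#) r * pow q (triangle r ℕ.+ 0) * (B₁ - pow q (suc (r ℕ.+ r)) * B₂)
        ≈⟨ *-congʳ (*-congˡ (pow-≡ q (ℕₚ.+-identityʳ (triangle r)))) ⟩
      pow (- 1#) r * pow q (triangle r) * (B₁ - pow q (suc (r ℕ.+ r)) * B₂)
        ≈⟨ solve 5 (λ s u v B₁ B₂ → s :* u :* (B₁ :- v :* B₂) := s :* u :* B₁ :+ :- :1 :* s :* (u :* v) :* B₂) refl _ _ _ B₁ B₂ ⟩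
      a r + pow (- 1#) (suc r) * (pow q (triangle r) * pow q (suc (r ℕ.+ r))) * B₂
        ≈⟨ +-congˡ (*-congʳ (*-congˡ (pow-*₂ q (triangle r) (suc (r ℕ.+ r)) (arith r (triangle r))))) ⟩
      a r + b r ∎
      where
      B₁ = qBinom q (n ℕ.+ n) (n ℕ.+ r)
      B₂ = qBinom q (n ℕ.+ n) (suc (n ℕ.+ r))
      arith : ∀ r u → u ℕ.+ suc (r ℕ.+ r) ≡ suc r ℕ.+ (r ℕ.+ u)
      arith = solve-∀
    upper : ∀ r → t (n ℕ.+ r) ≈ κ * b′ r
    upper r = begin
      pow (- 1#) (n ℕ.+ r) * pow q (triangle (n ℕ.+ r)) * pow (pow q e) (n ℕ.+ r) * B
        ≈⟨ *-congʳ (trans (*-assoc _ _ _) (*-cong (pow-+ (- 1#) n r) exponents)) ⟩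
      pow (- 1#) n * pow (- 1#) r * (pow q (triangle n ℕ.+ n ℕ.* e) * pow q (triangle (suc r))) * B
        ≈⟨ solve 5 (λ s u x y B → s :* u :* (x :* y) :* B := s :* x :* (u :* y :* B)) refl _ _ _ _ B ⟩
      κ * b′ r ∎
      where
      B = qBinom q (n ℕ.+ n) (n ℕ.+ r)
      arith : ∀ n′ e r T t → T ℕ.+ t ℕ.+ suc n′ ℕ.* r ℕ.+ (suc n′ ℕ.+ r) ℕ.* e ℕ.+ 0 ≡ T ℕ.+ suc n′ ℕ.* e ℕ.+ (r ℕ.+ t) ℕ.+ r ℕ.* (n′ ℕ.+ e)
      arith = solve-∀
      exponents : pow q (triangle (n ℕ.+ r)) * pow (pow q e) (n ℕ.+ r) ≈ pow q (triangle n ℕ.+ n ℕ.* e) * pow q (triangle (suc r))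
      exponents = begin
        pow q (triangle (n ℕ.+ r)) * pow (pow q e) (n ℕ.+ r)
          ≈⟨ *-cong (pow-≡ q (triangle-+ n r)) (pow-pow q e (n ℕ.+ r)) ⟩
        pow q (triangle n ℕ.+ triangle r ℕ.+ n ℕ.* r) * pow q ((n ℕ.+ r) ℕ.* e)
          ≈⟨ pow-*₂ q (triangle n ℕ.+ triangle r ℕ.+ n ℕ.* r) _ ≡.refl ⟩
        pow q (triangle n ℕ.+ triangle r ℕ.+ n ℕ.* r ℕ.+ (n ℕ.+ r) ℕ.* e)
          ≈⟨ pow-mod n′+e≡N 0 r (arith n′ e r (triangle n) (triangle r)) ⟩
        pow q (triangle n ℕ.+ n ℕ.* e ℕ.+ triangle (suc r))
          ≈⟨ pow-+ q (triangle n ℕ.+ n ℕ.* e) _ ⟩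
        pow q (triangle n ℕ.+ n ℕ.* e) * pow q (triangle (suc r)) ∎
    lower : ∀ s → s < n → t (n ∸ suc s) ≈ κ * a (suc s)
    lower s (s≤s s≤n′) with ℕₚ.m≤n⇒∃[o]m+o≡n s≤n′
    ... | (k , ≡.refl) = begin
      t (s ℕ.+ k ∸ s)
        ≈⟨ reflexive (≡.cong t (ℕₚ.m+n∸m≡n s k)) ⟩
      pow (- 1#) k * pow q (triangle k) * pow (pow q e) k * qBinom q (n ℕ.+ n) k
        ≈⟨ *-cong (*-assoc _ _ _) (qBinom-sym (n ℕ.+ n) k (n ℕ.+ suc s) (arith₁ s k)) ⟩
      pow (- 1#) k * (pow q (triangle k) * pow (pow q e) k) * B
        ≈⟨ *-congʳ (*-cong sign exponents) ⟩
      pow (- 1#) n * pow (- 1#) (suc s) * (pow q (triangle n ℕ.+ n ℕ.* e) * pow q (triangle (suc s))) * B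
        ≈⟨ solve 5 (λ s u x y B → s :* u :* (x :* y) :* B := s :* x :* (u :* y :* B)) refl _ _ _ _ B ⟩
      κ * a (suc s) ∎
      where
      B = qBinom q (n ℕ.+ n) (n ℕ.+ suc s)
      arith₁ : ∀ s k → suc (s ℕ.+ k) ℕ.+ suc (s ℕ.+ k) ≡ k ℕ.+ (suc (s ℕ.+ k) ℕ.+ suc s)
      arith₁ = solve-∀
      arith₃ : ∀ s k e t → t ℕ.+ k ℕ.* e ℕ.+ suc s ℕ.* (s ℕ.+ k ℕ.+ e)
             ≡ t ℕ.+ suc s ℕ.* k ℕ.+ suc (s ℕ.+ k) ℕ.* e ℕ.+ s ℕ.* suc s
      arith₃ = solve-∀
      arith₄ : ∀ x y z T → x ℕ.+ y ℕ.+ z ℕ.+ (T ℕ.+ T) ≡ T ℕ.+ x ℕ.+ y ℕ.+ z ℕ.+ T ℕ.+ 0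
      arith₄ = solve-∀
      sign : pow (- 1#) k ≈ pow (- 1#) n * pow (- 1#) (suc s)
      sign = begin
        pow (- 1#) k ≈⟨ sym (*-identityˡ _) ⟩
        1# * pow (- 1#) k ≈⟨ *-congʳ (sym (sign² (suc s))) ⟩
        pow (- 1#) (suc s) * pow (- 1#) (suc s) * pow (- 1#) k ≈⟨ solve 2 (λ x y → x :* x :* y := x :* y :* x) refl _ _ ⟩
        pow (- 1#) (suc s) * pow (- 1#) k * pow (- 1#) (suc s) ≈⟨ *-congʳ (sym (pow-+ (- 1#) (suc s) k)) ⟩
        pow (- 1#) n * pow (- 1#) (suc s) ∎
      exponents : pow q (triangle k) * pow (pow q e) k ≈ pow q (triangle n ℕ.+ n ℕ.* e) * pow q (triangle (suc s))
      exponents = begin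
        pow q (triangle k) * pow (pow q e) k
          ≈⟨ trans (*-congˡ (pow-pow q e k)) (pow-*₂ q (triangle k) (k ℕ.* e) ≡.refl) ⟩
        pow q (triangle k ℕ.+ k ℕ.* e)
          ≈⟨ pow-mod {a = triangle k ℕ.+ k ℕ.* e} n′+e≡N (suc s) 0 (≡.trans (arith₃ s k e (triangle k)) (≡.trans
                (≡.cong (triangle k ℕ.+ suc s ℕ.* k ℕ.+ n ℕ.* e ℕ.+_) (≡.sym (triangle-double s)))
                (arith₄ (triangle k) (suc s ℕ.* k) (n ℕ.* e) (triangle (suc s))))) ⟩
        pow q (triangle (suc s) ℕ.+ triangle k ℕ.+ suc s ℕ.* k ℕ.+ n ℕ.* e ℕ.+ triangle (suc s))
          ≈⟨ pow-≡ q (≡.cong (λ x → x ℕ.+ n ℕ.* e ℕ.+ triangle (suc s)) (≡.sym (triangle-+ (suc s) k))) ⟩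
        pow q (triangle n ℕ.+ n ℕ.* e ℕ.+ triangle (suc s))
          ≈⟨ pow-+ q (triangle n ℕ.+ n ℕ.* e) _ ⟩
        pow q (triangle n ℕ.+ n ℕ.* e) * pow q (triangle (suc s)) ∎
    scaled : alternating (n ℕ.+ n) (pow q e) ≈ κ * (sumBelow n (λ s → a (suc s)) + sumBelow (suc n) b′)
    scaled = begin
      sumBelow (suc (n ℕ.+ n)) t
        ≡⟨ ≡.cong (λ k → sumBelow k t) (≡.sym (ℕₚ.+-suc n n)) ⟩
      sumBelow (n ℕ.+ suc n) t
        ≈⟨ sum-split n (suc n) t ⟩
      sumBelow n t + sumBelow (suc n) (λ r → t (n ℕ.+ r))
        ≈⟨ +-cong (trans (sum-reverse n t) (sum-cong< n lower)) (sum-cong (suc n) upper) ⟩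
      sumBelow n (λ s → κ * a (suc s)) + sumBelow (suc n) (λ r → κ * b′ r)
        ≈⟨ +-cong (sum-*ˡ n κ _) (sum-*ˡ (suc n) κ b′) ⟩
      κ * sumBelow n (λ s → a (suc s)) + κ * sumBelow (suc n) b′
        ≈⟨ sym (distribˡ κ _ _) ⟩
      κ * (sumBelow n (λ s → a (suc s)) + sumBelow (suc n) b′) ∎
    alternating≈0 : alternating (n ℕ.+ n) (pow q e) ≈ 0#
    alternating≈0 = alternating-zero (n ℕ.+ n) n′ (pow q e) (s≤s (ℕₚ.m≤m+n n′ n))
      (trans (pow-*₂ q e n′ (≡.trans (ℕₚ.+-comm e n′) n′+e≡N)) q^N≈1)

  BaileyPair-cong : ∀ {α α′ β β′} → (∀ r → α r ≈ α′ r) → (∀ n → β n ≈ β′ n) → BaileyPair α β → BaileyPair α′ β′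
  BaileyPair-cong α≈α′ β≈β′ pair n 2n<N = trans (*-congˡ (sym (β≈β′ n)))
    (trans (pair n 2n<N) (sum-cong (suc n) (λ r → *-congʳ (α≈α′ r))))

  unitα-suc : ∀ p r → pow q (r ℕ.* suc r) * unitα p r ≈ unitα (suc p) r
  unitα-suc p r = begin
    pow q (r ℕ.* suc r) * (pow (- 1#) r * pow q (triangle r ℕ.+ p ℕ.* (r ℕ.* suc r)))
      ≈⟨ solve 3 (λ a s b → a :* (s :* b) := s :* (a :* b)) refl _ _ _ ⟩
    pow (- 1#) r * (pow q (r ℕ.* suc r) * pow q (triangle r ℕ.+ p ℕ.* (r ℕ.* suc r)))
      ≈⟨ *-congˡ (pow-*₂ q (r ℕ.* suc r) _ (arith (r ℕ.* suc r) (triangle r) (p ℕ.* (r ℕ.* suc r)))) ⟩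
    unitα (suc p) r ∎
    where
    arith : ∀ a b c → a ℕ.+ (b ℕ.+ c) ≡ b ℕ.+ (a ℕ.+ c)
    arith = solve-∀

  -- One step already turns the unit β into the constant 1, which is `inner q 0`; hence j + 1 steps
  -- for `inner q j`.
  innerPair : ∀ j → BaileyPair (unitα (suc j)) (inner q j)
  innerPair zero = BaileyPair-cong (unitα-suc 0) first (baileyStep unitPair)
    where
    first : ∀ n → sumTo n (λ m → pow q (m ℕ.* suc m) * qBinom q n m * unitβ m) ≈ 1#
    first n = begin
      sumTo n t ≈⟨ sumTo≈sumBelow n t ⟩
      sumBelow (suc n) t ≈⟨ sum-head n t ⟩
      1# * 1# * 1# + sumBelow n (λ m → t (suc m)) ≈⟨ +-congˡ (sum-zero n (λ m _ → zeroʳ _)) ⟩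
      1# * 1# * 1# + 0# ≈⟨ solve 0 (:1 :* :1 :* :1 :+ :0 := :1) refl ⟩
      1# ∎
      where
      t : ℕ → Carrier
      t m = pow q (m ℕ.* suc m) * qBinom q n m * unitβ m
  innerPair (suc j) = BaileyPair-cong (unitα-suc (suc j)) (λ n → refl) (baileyStep (innerPair j))

  -- Half and third multiples of N in the exponent.

  -- For even N primitivity forces q^(N/2) = -1, the only other root of x² = 1 in a domain; for odd
  -- N, the number k must be even. This lets signs be traded for powers of q.
  pow-half : ∀ k e → e ℕ.+ e ≡ k ℕ.* N → pow q e ≈ pow (- 1#) k
  pow-half k e eq with parity k | parity N | ≡.refl {x = N}
  ... | even j | _ | _ = begin
    pow q e                       ≈⟨ pow-≡ q (double-injective e (j ℕ.* N) (≡.trans eq (ℕₚ.*-distribʳ-+ N j j))) ⟩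
    pow q (j ℕ.* N)               ≈⟨ pow-N* j ⟩
    1#                            ≈⟨ sym (sign² j) ⟩
    pow (- 1#) j * pow (- 1#) j   ≈⟨ sym (pow-+ (- 1#) j j) ⟩
    pow (- 1#) (j ℕ.+ j)          ∎
  ... | odd j | odd f | _ = ⊥-elim (even≢odd e (j ℕ.* suc (f ℕ.+ f) ℕ.+ f) (≡.trans eq (arith j f)))
    where
    arith : ∀ j f → suc (j ℕ.+ j) ℕ.* suc (f ℕ.+ f) ≡ suc (j ℕ.* suc (f ℕ.+ f) ℕ.+ f ℕ.+ (j ℕ.* suc (f ℕ.+ f) ℕ.+ f))
    arith = solve-∀
  ... | odd j | even f | f+f≡N = begin
    pow q e                             ≈⟨ pow-≡ q (double-injective e (f ℕ.+ j ℕ.* (f ℕ.+ f)) (≡.trans eq (arith j f))) ⟩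
    pow q (f ℕ.+ j ℕ.* (f ℕ.+ f))       ≈⟨ trans (pow-+ q f _) (*-congˡ (pow-N* j)) ⟩
    pow q f * 1#                        ≈⟨ *-identityʳ _ ⟩
    pow q f                             ≈⟨ q^f≈-1 ⟩
    - 1#                                ≈⟨ solve 0 (:- :1 := :- :1 :* :1) refl ⟩
    - 1# * 1#                           ≈⟨ *-congˡ (sym (trans (pow-+ (- 1#) j j) (sign² j))) ⟩
    pow (- 1#) (suc (j ℕ.+ j))          ∎
    where
    arith : ∀ j f → suc (j ℕ.+ j) ℕ.* (f ℕ.+ f) ≡ f ℕ.+ j ℕ.* (f ℕ.+ f) ℕ.+ (f ℕ.+ j ℕ.* (f ℕ.+ f))
    arith = solve-∀
    0<f : 0 < f
    0<f = ℕₚ.n≢0⇒n>0 (λ f≡0 → ℕₚ.<⇒≢ 1≤N (≡.sym (≡.cong (λ f → f ℕ.+ f) f≡0)))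
    product≈0 : (1# - pow q f) * (1# + pow q f) ≈ 0#
    product≈0 = begin
      (1# - pow q f) * (1# + pow q f) ≈⟨ solve 1 (λ x → (:1 :- x) :* (:1 :+ x) := :1 :- x :* x) refl _ ⟩
      1# - pow q f * pow q f          ≈⟨ +-congˡ (-‿cong (trans (pow-*₂ q f f ≡.refl) q^N≈1)) ⟩
      1# - 1#                         ≈⟨ -‿inverseʳ 1# ⟩
      0#                              ∎
    q^f≈-1 : pow q f ≈ - 1#
    q^f≈-1 with integral _ _ product≈0
    ... | inj₁ 1-q^f≈0 = ⊥-elim (1-q^-nonzero f refl 0<f (ℕₚ.m<m+n f 0<f) 1-q^f≈0)
    ... | inj₂ 1+q^f≈0 = begin
      pow q f                 ≈⟨ solve 1 (λ x → x := :1 :+ x :- :1) refl _ ⟩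
      1# + pow q f - 1#       ≈⟨ +-congʳ 1+q^f≈0 ⟩
      0# - 1#                 ≈⟨ +-identityˡ _ ⟩
      - 1#                    ∎

  -- With N = 3s, primitivity gives q^s ≠ 1, so q^s is a root of 1 + x + x².
  pow-third : ∀ s b → s ℕ.* 3 ≡ N → pow q b + pow q (b ℕ.+ s) + pow q (b ℕ.+ (s ℕ.+ s)) ≈ 0#
  pow-third s b 3s≡N with integral _ _ product≈0
    where
    product≈0 : (1# - pow q s) * (1# + pow q s + pow q s * pow q s) ≈ 0#
    product≈0 = begin
      (1# - pow q s) * (1# + pow q s + pow q s * pow q s)
        ≈⟨ solve 1 (λ x → (:1 :- x) :* (:1 :+ x :+ x :* x) := :1 :- x :* x :* x) refl _ ⟩
      1# - pow q s * pow q s * pow q s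
        ≈⟨ +-congˡ (-‿cong (trans (pow-*₃ q s s s (≡.trans (arith s) 3s≡N)) q^N≈1)) ⟩
      1# - 1#
        ≈⟨ -‿inverseʳ 1# ⟩
      0# ∎
      where
      arith : ∀ s → s ℕ.+ s ℕ.+ s ≡ s ℕ.* 3
      arith = solve-∀
  ... | inj₁ 1-q^s≈0 = ⊥-elim (1-q^-nonzero s refl 0<s (≡.subst (s <_) 3s≡N (ℕₚ.m<m*n s 3 {{ℕ.>-nonZero 0<s}} (s≤s (s≤s z≤n)))) 1-q^s≈0)
    where
    0<s : 0 < s
    0<s = ℕₚ.n≢0⇒n>0 (λ s≡0 → ℕₚ.<⇒≢ 1≤N (≡.trans (≡.sym (≡.cong (ℕ._* 3) s≡0)) 3s≡N))
  ... | inj₂ 1+ω+ω²≈0 = begin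
    pow q b + pow q (b ℕ.+ s) + pow q (b ℕ.+ (s ℕ.+ s))
      ≈⟨ +-cong (+-congˡ (pow-+ q b s)) (trans (pow-+ q b (s ℕ.+ s)) (*-congˡ (pow-+ q s s))) ⟩
    pow q b + pow q b * pow q s + pow q b * (pow q s * pow q s)
      ≈⟨ solve 2 (λ b x → b :+ b :* x :+ b :* (x :* x) := b :* (:1 :+ x :+ x :* x)) refl _ _ ⟩
    pow q b * (1# + pow q s + pow q s * pow q s)
      ≈⟨ trans (*-congˡ 1+ω+ω²≈0) (zeroʳ _) ⟩
    0# ∎

  -- Reflection of q-binomials modulo N.

  -- The map k → N - k carries the exponents a+1, ..., a+i to a′+i, ..., a′+1. The order is
  -- reversed, so the last factor on the left is matched with the first on the right.
  qPoch-reflect : ∀ i a a′ → a ℕ.+ a′ ℕ.+ suc i ≡ N →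
    qPoch q (pow q (suc a)) i ≈ pow (- 1#) i * pow q (a ℕ.* i ℕ.+ triangle (suc i)) * qPoch q (pow q (suc a′)) i
  qPoch-reflect zero a a′ _ = begin
    1#                                       ≈⟨ solve 0 (:1 := :1 :* :1 :* :1) refl ⟩
    1# * pow q 0 * 1#                        ≈⟨ *-congʳ (*-congˡ (pow-≡ q (arith a))) ⟩
    1# * pow q (a ℕ.* 0 ℕ.+ 0) * 1#          ∎
    where
    arith : ∀ a → 0 ≡ a ℕ.* 0 ℕ.+ 0
    arith = solve-∀
  qPoch-reflect (suc i) a a′ eq = begin
    qPoch q (pow q (suc a)) i * (1# - A)
      ≈⟨ *-cong (qPoch-reflect i a (suc a′) (≡.trans (arith₁ a a′ i) eq)) 1-A ⟩
    pow (- 1#) i * pow q E * P * (- 1# * A * (1# - B))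
      ≈⟨ solve 5 (λ s E P A B → s :* E :* P :* (:- :1 :* A :* (:1 :- B)) := :- :1 :* s :* (E :* A) :* ((:1 :- B) :* P)) refl _ _ P A B ⟩
    - 1# * pow (- 1#) i * (pow q E * A) * ((1# - B) * P)
      ≈⟨ *-cong (*-congˡ exponents) (*-congˡ (qPoch-cong i (*-comm q B))) ⟩
    - 1# * pow (- 1#) i * pow q (a ℕ.* suc i ℕ.+ triangle (2 ℕ.+ i)) * ((1# - B) * qPoch q (B * q) i)
      ≈⟨ *-congˡ (sym (qPoch-head B i)) ⟩
    pow (- 1#) (suc i) * pow q (a ℕ.* suc i ℕ.+ triangle (2 ℕ.+ i)) * qPoch q B (suc i) ∎
    where
    A = pow q (suc a) * pow q i
    B = pow q (suc a′)
    E = a ℕ.* i ℕ.+ triangle (suc i)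
    P = qPoch q (pow q (suc (suc a′))) i
    arith₁ : ∀ a a′ i → a ℕ.+ suc a′ ℕ.+ suc i ≡ a ℕ.+ a′ ℕ.+ suc (suc i)
    arith₁ = solve-∀
    arith₂ : ∀ a a′ i → suc a ℕ.+ i ℕ.+ suc a′ ≡ a ℕ.+ a′ ℕ.+ suc (suc i)
    arith₂ = solve-∀
    arith₃ : ∀ a i t → a ℕ.* i ℕ.+ t ℕ.+ (suc a ℕ.+ i) ≡ a ℕ.* suc i ℕ.+ (suc i ℕ.+ t)
    arith₃ = solve-∀
    1-A : 1# - A ≈ - 1# * A * (1# - B)
    1-A = begin
      1# - A               ≈⟨ +-congʳ (sym (trans (pow-*₃ q (suc a) i (suc a′) (≡.trans (arith₂ a a′ i) eq)) q^N≈1)) ⟩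
      A * B - A            ≈⟨ solve 2 (λ A B → A :* B :- A := :- :1 :* A :* (:1 :- B)) refl A B ⟩
      - 1# * A * (1# - B)  ∎
    exponents : pow q E * A ≈ pow q (a ℕ.* suc i ℕ.+ triangle (2 ℕ.+ i))
    exponents = trans (*-congˡ (sym (pow-+ q (suc a) i))) (pow-*₂ q E (suc a ℕ.+ i) (arith₃ a i (triangle (suc i))))

  qFactorial-*-qBinom : ∀ a i → a < N → qFactorial i * qBinom q (a ℕ.+ i) i ≈ qPoch q (pow q (suc a)) i
  qFactorial-*-qBinom a i a<N = *-cancelˡ (qFactorial-nonzero a a<N) (begin
    qFactorial a * (qFactorial i * qBinom q (a ℕ.+ i) i)
      ≈⟨ solve 3 (λ a i b → a :* (i :* b) := b :* (i :* a)) refl _ _ _ ⟩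
    qBinom q (a ℕ.+ i) i * (qFactorial i * qFactorial a)
      ≈⟨ qBinom-qFactorial (a ℕ.+ i) i a (ℕₚ.+-comm a i) ⟩
    qFactorial (a ℕ.+ i)
      ≈⟨ qFactorial-+ a i ⟩
    qFactorial a * qPoch q (pow q (suc a)) i ∎)

  -- Modulo N the upper index a + i is -(a′+1), so this is the rule for q-binomials with negative
  -- upper index.
  qBinom-reflect : ∀ i a a′ → a ℕ.+ a′ ℕ.+ suc i ≡ N →
    qBinom q (a ℕ.+ i) i ≈ pow (- 1#) i * pow q (a ℕ.* i ℕ.+ triangle (suc i)) * qBinom q (a′ ℕ.+ i) i
  qBinom-reflect i a a′ eq = *-cancelˡ (qFactorial-nonzero i (bound i (a ℕ.+ a′) (arith₁ a a′ i))) (begin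
    qFactorial i * qBinom q (a ℕ.+ i) i
      ≈⟨ qFactorial-*-qBinom a i (bound a (a′ ℕ.+ i) (arith₂ a a′ i)) ⟩
    qPoch q (pow q (suc a)) i
      ≈⟨ qPoch-reflect i a a′ eq ⟩
    X * qPoch q (pow q (suc a′)) i
      ≈⟨ *-congˡ (sym (qFactorial-*-qBinom a′ i (bound a′ (a ℕ.+ i) (arith₃ a a′ i)))) ⟩
    X * (qFactorial i * qBinom q (a′ ℕ.+ i) i)
      ≈⟨ solve 3 (λ x f b → x :* (f :* b) := f :* (x :* b)) refl X _ _ ⟩
    qFactorial i * (X * qBinom q (a′ ℕ.+ i) i) ∎)
    where
    X = pow (- 1#) i * pow q (a ℕ.* i ℕ.+ triangle (suc i))
    bound : ∀ x y → suc x ℕ.+ y ≡ a ℕ.+ a′ ℕ.+ suc i → x < N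
    bound x y e = ℕₚ.≤-trans (ℕₚ.m≤m+n (suc x) y) (ℕₚ.≤-reflexive (≡.trans e eq))
    arith₁ : ∀ a a′ i → suc i ℕ.+ (a ℕ.+ a′) ≡ a ℕ.+ a′ ℕ.+ suc i
    arith₁ = solve-∀
    arith₂ : ∀ a a′ i → suc a ℕ.+ (a′ ℕ.+ i) ≡ a ℕ.+ a′ ℕ.+ suc i
    arith₂ = solve-∀
    arith₃ : ∀ a a′ i → suc a′ ℕ.+ (a ℕ.+ i) ≡ a ℕ.+ a′ ℕ.+ suc i
    arith₃ = solve-∀

  -- Evaluation of the sums U_r.

  centralSum : ℕ → ℕ → Carrier
  centralSum h r = sumBelow h (λ n → pow q (n ℕ.+ r ℕ.* r) * qBinom q (n ℕ.+ n) (n ℕ.+ r))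

  -- With n = r + i the reflection turns [2n, i] into [M-i, i]. Of the bounds on `B`, M < 2B makes
  -- `schur-sum` complete and 2B ≤ M + 2 ensures 2i ≤ M, so that the reflected lower parameter M -
  -- 2i exists.
  centralSum-schur : ∀ r B M → suc (r ℕ.+ r) ℕ.+ M ≡ N → M < B ℕ.+ B → B ℕ.+ B ≤ 2 ℕ.+ M →
    centralSum (r ℕ.+ B) r ≈ pow q (r ℕ.* r ℕ.+ r) * schur M (pow q (suc (r ℕ.+ r)))
  centralSum-schur r B M eq M<2B 2B≤2+M = begin
    sumBelow (r ℕ.+ B) t
      ≈⟨ sum-split r B t ⟩
    sumBelow r t + sumBelow B (λ i → t (r ℕ.+ i))
      ≈⟨ +-cong (sum-zero r (λ n n<r → trans (*-congˡ (qBinom-zero (ℕₚ.+-monoʳ-< n n<r))) (zeroʳ _))) (sum-cong< B term) ⟩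
    0# + sumBelow B (λ i → pow q (r ℕ.* r ℕ.+ r) * schurTerm M x i)
      ≈⟨ trans (+-identityˡ _) (sum-*ˡ B _ _) ⟩
    pow q (r ℕ.* r ℕ.+ r) * sumBelow B (schurTerm M x)
      ≈⟨ *-congˡ (sym (schur-sum M B x M<2B)) ⟩
    pow q (r ℕ.* r ℕ.+ r) * schur M x ∎
    where
    x = pow q (suc (r ℕ.+ r))
    t : ℕ → Carrier
    t n = pow q (n ℕ.+ r ℕ.* r) * qBinom q (n ℕ.+ n) (n ℕ.+ r)
    term : ∀ i → i < B → t (r ℕ.+ i) ≈ pow q (r ℕ.* r ℕ.+ r) * schurTerm M x i
    term i i<B with ℕₚ.m≤n⇒∃[o]m+o≡n 2i≤M
      where
      2i≤M : i ℕ.+ i ≤ M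
      2i≤M = ℕₚ.≤-pred (ℕₚ.≤-pred (ℕₚ.≤-trans (ℕₚ.≤-reflexive (≡.cong suc (≡.sym (ℕₚ.+-suc i i)))) (ℕₚ.≤-trans (ℕₚ.+-mono-≤ i<B i<B) 2B≤2+M)))
    ... | (d , ≡.refl) = begin
      pow q (n ℕ.+ r ℕ.* r) * qBinom q (n ℕ.+ n) (n ℕ.+ r)
        ≈⟨ *-congˡ (trans (qBinom-sym (n ℕ.+ n) (n ℕ.+ r) i (arith₁ r i)) (reflexive (≡.cong (λ k → qBinom q k i) (arith₂ r i)))) ⟩
      pow q (n ℕ.+ r ℕ.* r) * qBinom q (a ℕ.+ i) i
        ≈⟨ *-congˡ (qBinom-reflect i a d (≡.trans (arith₃ r i d) eq)) ⟩
      pow q (n ℕ.+ r ℕ.* r) * (pow (- 1#) i * pow q (a ℕ.* i ℕ.+ triangle (suc i)) * b)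
        ≈⟨ solve 4 (λ u s v b → u :* (s :* v :* b) := s :* (u :* v) :* b) refl _ _ _ b ⟩
      pow (- 1#) i * (pow q (n ℕ.+ r ℕ.* r) * pow q (a ℕ.* i ℕ.+ triangle (suc i))) * b
        ≈⟨ *-congʳ (*-congˡ exponents) ⟩
      pow (- 1#) i * (pow q (r ℕ.* r ℕ.+ r) * pow x i * pow q E) * b
        ≈⟨ solve 5 (λ s u y e b → s :* (u :* y :* e) :* b := u :* (s :* (y :* e) :* b)) refl _ _ _ _ b ⟩
      pow q (r ℕ.* r ℕ.+ r) * (pow (- 1#) i * (pow x i * pow q E) * b)
        ≈⟨ *-congˡ (*-congˡ (reflexive (≡.cong (λ k → qBinom q k i) (≡.sym M∸i)))) ⟩
      pow q (r ℕ.* r ℕ.+ r) * schurTerm (i ℕ.+ i ℕ.+ d) x i ∎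
      where
      n = r ℕ.+ i
      a = r ℕ.+ r ℕ.+ i
      b = qBinom q (d ℕ.+ i) i
      E = i ℕ.* i ℕ.+ triangle (suc i)
      M∸i : i ℕ.+ i ℕ.+ d ∸ i ≡ d ℕ.+ i
      M∸i = ≡.trans (≡.cong (_∸ i) (≡.trans (ℕₚ.+-assoc i i d) (≡.cong (i ℕ.+_) (ℕₚ.+-comm i d)))) (ℕₚ.m+n∸m≡n i (d ℕ.+ i))
      arith₁ : ∀ r i → r ℕ.+ i ℕ.+ (r ℕ.+ i) ≡ r ℕ.+ i ℕ.+ r ℕ.+ i
      arith₁ = solve-∀
      arith₂ : ∀ r i → r ℕ.+ i ℕ.+ (r ℕ.+ i) ≡ r ℕ.+ r ℕ.+ i ℕ.+ i
      arith₂ = solve-∀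
      arith₃ : ∀ r i d → r ℕ.+ r ℕ.+ i ℕ.+ d ℕ.+ suc i ≡ suc (r ℕ.+ r) ℕ.+ (i ℕ.+ i ℕ.+ d)
      arith₃ = solve-∀
      arith₄ : ∀ r i t → r ℕ.+ i ℕ.+ r ℕ.* r ℕ.+ ((r ℕ.+ r ℕ.+ i) ℕ.* i ℕ.+ t) ≡ r ℕ.* r ℕ.+ r ℕ.+ i ℕ.* suc (r ℕ.+ r) ℕ.+ (i ℕ.* i ℕ.+ t)
      arith₄ = solve-∀
      exponents : pow q (n ℕ.+ r ℕ.* r) * pow q (a ℕ.* i ℕ.+ triangle (suc i)) ≈ pow q (r ℕ.* r ℕ.+ r) * pow x i * pow q E
      exponents = begin
        pow q (n ℕ.+ r ℕ.* r) * pow q (a ℕ.* i ℕ.+ triangle (suc i))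
          ≈⟨ pow-*₂ q (n ℕ.+ r ℕ.* r) _ (arith₄ r i (triangle (suc i))) ⟩
        pow q (r ℕ.* r ℕ.+ r ℕ.+ i ℕ.* suc (r ℕ.+ r) ℕ.+ E)
          ≈⟨ sym (pow-*₃ q (r ℕ.* r ℕ.+ r) (i ℕ.* suc (r ℕ.+ r)) E ≡.refl) ⟩
        pow q (r ℕ.* r ℕ.+ r) * pow q (i ℕ.* suc (r ℕ.+ r)) * pow q E
          ≈⟨ *-congʳ (*-congˡ (sym (pow-pow q (suc (r ℕ.+ r)) i))) ⟩
        pow q (r ℕ.* r ℕ.+ r) * pow x i * pow q E ∎

  centralSum-end : ∀ r → centralSum r r ≈ 0#
  centralSum-end r = sum-zero r (λ n n<r → trans (*-congˡ (qBinom-zero (ℕₚ.+-monoʳ-< n n<r))) (zeroʳ _))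

  scaledSchur : ℕ → ℕ → Carrier
  scaledSchur r M = pow q (r ℕ.* r ℕ.+ r) * schur M (pow q (suc (r ℕ.+ r)))

  -- At x = q^(2r+1) the hypothesis of `schur-iterate` is just q^N = 1.
  scaledSchur-iterate : ∀ r m M → suc (r ℕ.+ r) ℕ.+ (M ℕ.+ m ℕ.* 3) ≡ N →
    scaledSchur r (M ℕ.+ m ℕ.* 3) ≈
      pow (- 1#) m * pow q (r ℕ.* r ℕ.+ r ℕ.+ (m ℕ.* suc (r ℕ.+ r) ℕ.+ (m ℕ.+ m ℕ.+ 3 ℕ.* triangle m)))
        * schur M (pow q (suc (r ℕ.+ r)) * pow q (m ℕ.* 3))
  scaledSchur-iterate r m M eq = begin
    u * schur (M ℕ.+ m ℕ.* 3) x
      ≈⟨ *-congˡ (reflexive (≡.cong (λ k → schur k x) (ℕₚ.+-comm M (m ℕ.* 3)))) ⟩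
    u * schur (m ℕ.* 3 ℕ.+ M) x
      ≈⟨ *-congˡ (schur-iterate m M x (trans (pow-*₂ q (suc (r ℕ.+ r)) (m ℕ.* 3 ℕ.+ M) (≡.trans (≡.cong (suc (r ℕ.+ r) ℕ.+_) (ℕₚ.+-comm (m ℕ.* 3) M)) eq)) q^N≈1)) ⟩
    u * (pow (- 1#) m * (pow x m * v) * S)
      ≈⟨ solve 5 (λ u s y v S → u :* (s :* (y :* v) :* S) := s :* (u :* (y :* v)) :* S) refl u _ _ v S ⟩
    pow (- 1#) m * (u * (pow x m * v)) * S
      ≈⟨ *-congʳ (*-congˡ (trans (*-congˡ (trans (*-congʳ (pow-pow q (suc (r ℕ.+ r)) m)) (pow-*₂ q (m ℕ.* suc (r ℕ.+ r)) _ ≡.refl))) (pow-*₂ q (r ℕ.* r ℕ.+ r) _ ≡.refl))) ⟩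
    pow (- 1#) m * pow q (r ℕ.* r ℕ.+ r ℕ.+ (m ℕ.* suc (r ℕ.+ r) ℕ.+ (m ℕ.+ m ℕ.+ 3 ℕ.* triangle m))) * S ∎
    where
    x = pow q (suc (r ℕ.+ r))
    u = pow q (r ℕ.* r ℕ.+ r)
    v = pow q (m ℕ.+ m ℕ.+ 3 ℕ.* triangle m)
    S = schur M (x * pow q (m ℕ.* 3))

  -- The sign (-1)^m is rewritten as q^(mN/2), which leaves a pure power of q.
  scaledSchur₀ : ∀ r m → suc (r ℕ.+ r) ℕ.+ m ℕ.* 3 ≡ N → scaledSchur r (m ℕ.* 3) ≈ pow q (suc r ℕ.* (r ℕ.+ m))
  scaledSchur₀ r m eq = begin
    scaledSchur r (m ℕ.* 3)
      ≈⟨ scaledSchur-iterate r m 0 eq ⟩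
    pow (- 1#) m * pow q E * 1#
      ≈⟨ trans (*-identityʳ _) (*-congʳ (sym (pow-half m e 2e≡mN))) ⟩
    pow q e * pow q E
      ≈⟨ pow-*₂ q e E (≡.trans (arith₁ r m (triangle m)) (≡.cong (suc r ℕ.* (r ℕ.+ m) ℕ.+_) 2e≡mN)) ⟩
    pow q (suc r ℕ.* (r ℕ.+ m) ℕ.+ m ℕ.* N)
      ≈⟨ trans (pow-+ q (suc r ℕ.* (r ℕ.+ m)) (m ℕ.* N)) (trans (*-congˡ (pow-N* m)) (*-identityʳ _)) ⟩
    pow q (suc r ℕ.* (r ℕ.+ m)) ∎
    where
    E = r ℕ.* r ℕ.+ r ℕ.+ (m ℕ.* suc (r ℕ.+ r) ℕ.+ (m ℕ.+ m ℕ.+ 3 ℕ.* triangle m))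
    -- This is mN/2 for N = 2r + 1 + 3m, an integer as mN is even.
    e = m ℕ.* (2 ℕ.+ r) ℕ.+ 3 ℕ.* triangle m
    arith₁ : ∀ r m t → m ℕ.* (2 ℕ.+ r) ℕ.+ 3 ℕ.* t ℕ.+ (r ℕ.* r ℕ.+ r ℕ.+ (m ℕ.* suc (r ℕ.+ r) ℕ.+ (m ℕ.+ m ℕ.+ 3 ℕ.* t)))
           ≡ suc r ℕ.* (r ℕ.+ m) ℕ.+ (m ℕ.* (2 ℕ.+ r) ℕ.+ 3 ℕ.* t ℕ.+ (m ℕ.* (2 ℕ.+ r) ℕ.+ 3 ℕ.* t))
    arith₁ = solve-∀
    arith₂ : ∀ r m t → m ℕ.* (2 ℕ.+ r) ℕ.+ 3 ℕ.* t ℕ.+ (m ℕ.* (2 ℕ.+ r) ℕ.+ 3 ℕ.* t) ℕ.+ 6 ℕ.* m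
           ≡ 2 ℕ.* (m ℕ.* (2 ℕ.+ r)) ℕ.+ 3 ℕ.* (m ℕ.+ t ℕ.+ (m ℕ.+ t))
    arith₂ = solve-∀
    arith₃ : ∀ r m → 2 ℕ.* (m ℕ.* (2 ℕ.+ r)) ℕ.+ 3 ℕ.* (m ℕ.* suc m) ≡ m ℕ.* (suc (r ℕ.+ r) ℕ.+ m ℕ.* 3) ℕ.+ 6 ℕ.* m
    arith₃ = solve-∀
    2e≡mN : e ℕ.+ e ≡ m ℕ.* N
    2e≡mN = ≡.trans (ℕₚ.+-cancelʳ-≡ (6 ℕ.* m) _ _ (≡.trans (arith₂ r m (triangle m))
      (≡.trans (≡.cong (λ k → 2 ℕ.* (m ℕ.* (2 ℕ.+ r)) ℕ.+ 3 ℕ.* k) (triangle-double m)) (arith₃ r m)))) (≡.cong (m ℕ.*_) eq)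

  scaledSchur₁ : ∀ r m → suc (r ℕ.+ r) ℕ.+ (1 ℕ.+ m ℕ.* 3) ≡ N → scaledSchur r (1 ℕ.+ m ℕ.* 3) ≈ - pow q (suc ((2 ℕ.+ r) ℕ.* (r ℕ.+ m)))
  scaledSchur₁ r m eq = begin
    scaledSchur r (1 ℕ.+ m ℕ.* 3)
      ≈⟨ scaledSchur-iterate r m 1 eq ⟩
    pow (- 1#) m * pow q E * 1#
      ≈⟨ solve 2 (λ s E → s :* E :* :1 := :- (:- :1 :* s :* E)) refl _ _ ⟩
    - (pow (- 1#) (suc m) * pow q E)
      ≈⟨ -‿cong (*-congʳ (sym (pow-half (suc m) e 2e≡[1+m]N))) ⟩
    - (pow q e * pow q E)
      ≈⟨ -‿cong (pow-*₂ q e E total) ⟩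
    - pow q (suc ((2 ℕ.+ r) ℕ.* (r ℕ.+ m)) ℕ.+ m ℕ.* N)
      ≈⟨ -‿cong (trans (pow-+ q (suc ((2 ℕ.+ r) ℕ.* (r ℕ.+ m))) (m ℕ.* N)) (trans (*-congˡ (pow-N* m)) (*-identityʳ _))) ⟩
    - pow q (suc ((2 ℕ.+ r) ℕ.* (r ℕ.+ m))) ∎
    where
    E = r ℕ.* r ℕ.+ r ℕ.+ (m ℕ.* suc (r ℕ.+ r) ℕ.+ (m ℕ.+ m ℕ.+ 3 ℕ.* triangle m))
    -- This is (m+1)N/2. For N = 2r + 2 + 3m the number mN is odd when m is, whereas (m+1)N is
    -- always even; the additional sign is the minus in the result.
    e = m ℕ.* r ℕ.+ r ℕ.+ 1 ℕ.+ 4 ℕ.* m ℕ.+ 3 ℕ.* triangle m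
    arith₁ : ∀ r m t → m ℕ.* r ℕ.+ r ℕ.+ 1 ℕ.+ 4 ℕ.* m ℕ.+ 3 ℕ.* t ℕ.+ (r ℕ.* r ℕ.+ r ℕ.+ (m ℕ.* suc (r ℕ.+ r) ℕ.+ (m ℕ.+ m ℕ.+ 3 ℕ.* t))) ℕ.+ (m ℕ.+ r ℕ.+ 1)
           ≡ r ℕ.* r ℕ.+ r ℕ.+ m ℕ.* r ℕ.+ (m ℕ.* r ℕ.+ r ℕ.+ 1 ℕ.+ 4 ℕ.* m ℕ.+ 3 ℕ.* t ℕ.+ (m ℕ.* r ℕ.+ r ℕ.+ 1 ℕ.+ 4 ℕ.* m ℕ.+ 3 ℕ.* t))
    arith₁ = solve-∀
    arith₂ : ∀ r m t → m ℕ.* r ℕ.+ r ℕ.+ 1 ℕ.+ 4 ℕ.* m ℕ.+ 3 ℕ.* t ℕ.+ (m ℕ.* r ℕ.+ r ℕ.+ 1 ℕ.+ 4 ℕ.* m ℕ.+ 3 ℕ.* t)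
           ≡ 2 ℕ.* (m ℕ.* r ℕ.+ r ℕ.+ 1 ℕ.+ m) ℕ.+ 3 ℕ.* (m ℕ.+ t ℕ.+ (m ℕ.+ t))
    arith₂ = solve-∀
    arith₃ : ∀ r m → 2 ℕ.* (m ℕ.* r ℕ.+ r ℕ.+ 1 ℕ.+ m) ℕ.+ 3 ℕ.* (m ℕ.* suc m) ≡ suc m ℕ.* (suc (r ℕ.+ r) ℕ.+ (1 ℕ.+ m ℕ.* 3))
    arith₃ = solve-∀
    arith₄ : ∀ r m → r ℕ.* r ℕ.+ r ℕ.+ m ℕ.* r ℕ.+ suc m ℕ.* (suc (r ℕ.+ r) ℕ.+ (1 ℕ.+ m ℕ.* 3))
           ≡ suc ((2 ℕ.+ r) ℕ.* (r ℕ.+ m)) ℕ.+ m ℕ.* (suc (r ℕ.+ r) ℕ.+ (1 ℕ.+ m ℕ.* 3)) ℕ.+ (m ℕ.+ r ℕ.+ 1)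
    arith₄ = solve-∀
    2e : e ℕ.+ e ≡ suc m ℕ.* (suc (r ℕ.+ r) ℕ.+ (1 ℕ.+ m ℕ.* 3))
    2e = ≡.trans (arith₂ r m (triangle m))
      (≡.trans (≡.cong (λ k → 2 ℕ.* (m ℕ.* r ℕ.+ r ℕ.+ 1 ℕ.+ m) ℕ.+ 3 ℕ.* k) (triangle-double m)) (arith₃ r m))
    2e≡[1+m]N : e ℕ.+ e ≡ suc m ℕ.* N
    2e≡[1+m]N = ≡.trans 2e (≡.cong (suc m ℕ.*_) eq)
    total : e ℕ.+ E ≡ suc ((2 ℕ.+ r) ℕ.* (r ℕ.+ m)) ℕ.+ m ℕ.* N
    total = ≡.trans (ℕₚ.+-cancelʳ-≡ (m ℕ.+ r ℕ.+ 1) _ _ (≡.trans (arith₁ r m (triangle m))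
      (≡.trans (≡.cong (r ℕ.* r ℕ.+ r ℕ.+ m ℕ.* r ℕ.+_) 2e) (arith₄ r m)))) (≡.cong (λ k → suc ((2 ℕ.+ r) ℕ.* (r ℕ.+ m)) ℕ.+ m ℕ.* k) eq)

  -- The iteration ends in `schur 2 y` = 1 - y q² with y q² = q^N.
  scaledSchur₂ : ∀ r m → suc (r ℕ.+ r) ℕ.+ (2 ℕ.+ m ℕ.* 3) ≡ N → scaledSchur r (2 ℕ.+ m ℕ.* 3) ≈ 0#
  scaledSchur₂ r m eq = begin
    scaledSchur r (2 ℕ.+ m ℕ.* 3)
      ≈⟨ scaledSchur-iterate r m 2 eq ⟩
    s * (1# - x * pow q (m ℕ.* 3) * pow q 2 * 1#)
      ≈⟨ *-congˡ (+-congˡ (-‿cong (trans (*-identityʳ _) (trans (pow-*₃ q (suc (r ℕ.+ r)) (m ℕ.* 3) 2 (≡.trans (arith r m) eq)) q^N≈1)))) ⟩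
    s * (1# - 1#)
      ≈⟨ solve 1 (λ s → s :* (:1 :- :1) := :0) refl s ⟩
    0# ∎
    where
    x = pow q (suc (r ℕ.+ r))
    s = pow (- 1#) m * pow q (r ℕ.* r ℕ.+ r ℕ.+ (m ℕ.* suc (r ℕ.+ r) ℕ.+ (m ℕ.+ m ℕ.+ 3 ℕ.* triangle m)))
    arith : ∀ r m → suc (r ℕ.+ r) ℕ.+ m ℕ.* 3 ℕ.+ 2 ≡ suc (r ℕ.+ r) ℕ.+ (2 ℕ.+ m ℕ.* 3)
    arith = solve-∀

  -- If 3 does not divide N, either exactly one of V_(N-r) and V_r vanishes or the two agree modulo
  -- q^N = 1. The residues (0,1), (1,2), (2,0) of (M, r) are those with 3 dividing N: in the last
  -- both values vanish, in the other two both survive and `pow-third` merges them.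
  scaledSchur≈cubic-difference : ∀ r M → suc (r ℕ.+ r) ℕ.+ M ≡ N → scaledSchur r M ≈ cubic (suc r ℕ.+ M) - cubic r
  scaledSchur≈cubic-difference r M eq with residue₃ M | residue₃ r
  ... | 0+3* m | 0+3* t = begin
    scaledSchur r M                                       ≈⟨ scaledSchur₀ r m eq ⟩
    pow q (suc r ℕ.* (r ℕ.+ m))                           ≈⟨ pow-mod eq m t (arith₁ t m) ⟩
    pow q (3 ℕ.* T ℕ.* T ℕ.+ 2 ℕ.* T)                     ≈⟨ solve 1 (λ x → x := x :- :0) refl _ ⟩
    pow q (3 ℕ.* T ℕ.* T ℕ.+ 2 ℕ.* T) - 0#                ≈⟨ sym (+-cong (cubic₁ T (arith₂ t m)) (-‿cong (cubic₀ t ≡.refl))) ⟩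
    cubic (suc r ℕ.+ M) - cubic r                         ∎
    where
    T = t ℕ.+ m
    arith₁ : ∀ t m → suc (t ℕ.* 3) ℕ.* (t ℕ.* 3 ℕ.+ m) ℕ.+ m ℕ.* (suc (t ℕ.* 3 ℕ.+ t ℕ.* 3) ℕ.+ m ℕ.* 3)
           ≡ 3 ℕ.* (t ℕ.+ m) ℕ.* (t ℕ.+ m) ℕ.+ 2 ℕ.* (t ℕ.+ m) ℕ.+ t ℕ.* (suc (t ℕ.* 3 ℕ.+ t ℕ.* 3) ℕ.+ m ℕ.* 3)
    arith₁ = solve-∀
    arith₂ : ∀ t m → suc (t ℕ.* 3) ℕ.+ m ℕ.* 3 ≡ 1 ℕ.+ (t ℕ.+ m) ℕ.* 3
    arith₂ = solve-∀
  ... | 0+3* m | 1+3* t = begin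
    scaledSchur r M                                       ≈⟨ scaledSchur₀ r m eq ⟩
    pow q (suc r ℕ.* (r ℕ.+ m))                           ≈⟨ pow-mod eq 0 t (arith₁ t m) ⟩
    -- With s = N/3 and b the exponent of V_r, the three-term relation replaces this power by two
    -- others.
    pow q (b ℕ.+ (s ℕ.+ s))                               ≈⟨ solve 3 (λ x y z → z := x :+ y :+ z :- y :- x) refl (pow q b) (pow q (b ℕ.+ s)) _ ⟩
    pow q b + pow q (b ℕ.+ s) + pow q (b ℕ.+ (s ℕ.+ s)) - pow q (b ℕ.+ s) - pow q b
      ≈⟨ +-congʳ (trans (+-congʳ (pow-third s b (≡.trans (arith₂ t m) eq))) (+-identityˡ _)) ⟩
    - pow q (b ℕ.+ s) - pow q b                           ≈⟨ +-congʳ (-‿cong (pow-mod eq m 0 (arith₃ t m))) ⟩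
    - pow q (3 ℕ.* T ℕ.* T ℕ.+ 4 ℕ.* T ℕ.+ 1) - pow q b   ≈⟨ sym (+-cong (cubic₂ T (arith₄ t m)) (-‿cong (cubic₁ t ≡.refl))) ⟩
    cubic (suc r ℕ.+ M) - cubic r                         ∎
    where
    T = t ℕ.+ m
    s = 2 ℕ.* t ℕ.+ 1 ℕ.+ m
    b = 3 ℕ.* t ℕ.* t ℕ.+ 2 ℕ.* t
    arith₁ : ∀ t m → suc (1 ℕ.+ t ℕ.* 3) ℕ.* (1 ℕ.+ t ℕ.* 3 ℕ.+ m) ℕ.+ 0
           ≡ 3 ℕ.* t ℕ.* t ℕ.+ 2 ℕ.* t ℕ.+ (2 ℕ.* t ℕ.+ 1 ℕ.+ m ℕ.+ (2 ℕ.* t ℕ.+ 1 ℕ.+ m))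
             ℕ.+ t ℕ.* (suc (1 ℕ.+ t ℕ.* 3 ℕ.+ (1 ℕ.+ t ℕ.* 3)) ℕ.+ m ℕ.* 3)
    arith₁ = solve-∀
    arith₂ : ∀ t m → (2 ℕ.* t ℕ.+ 1 ℕ.+ m) ℕ.* 3 ≡ suc (1 ℕ.+ t ℕ.* 3 ℕ.+ (1 ℕ.+ t ℕ.* 3)) ℕ.+ m ℕ.* 3
    arith₂ = solve-∀
    arith₃ : ∀ t m → 3 ℕ.* t ℕ.* t ℕ.+ 2 ℕ.* t ℕ.+ (2 ℕ.* t ℕ.+ 1 ℕ.+ m) ℕ.+ m ℕ.* (suc (1 ℕ.+ t ℕ.* 3 ℕ.+ (1 ℕ.+ t ℕ.* 3)) ℕ.+ m ℕ.* 3)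
           ≡ 3 ℕ.* (t ℕ.+ m) ℕ.* (t ℕ.+ m) ℕ.+ 4 ℕ.* (t ℕ.+ m) ℕ.+ 1 ℕ.+ 0
    arith₃ = solve-∀
    arith₄ : ∀ t m → suc (1 ℕ.+ t ℕ.* 3) ℕ.+ m ℕ.* 3 ≡ 2 ℕ.+ (t ℕ.+ m) ℕ.* 3
    arith₄ = solve-∀
  ... | 0+3* m | 2+3* t = begin
    scaledSchur r M                                       ≈⟨ scaledSchur₀ r m eq ⟩
    pow q (suc r ℕ.* (r ℕ.+ m))                           ≈⟨ pow-mod eq 0 (suc t) (arith₁ t m) ⟩
    pow q (3 ℕ.* t ℕ.* t ℕ.+ 4 ℕ.* t ℕ.+ 1)               ≈⟨ solve 1 (λ x → x := :0 :- :- x) refl _ ⟩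
    0# - - pow q (3 ℕ.* t ℕ.* t ℕ.+ 4 ℕ.* t ℕ.+ 1)        ≈⟨ sym (+-cong (cubic₀ (suc (t ℕ.+ m)) (arith₂ t m)) (-‿cong (cubic₂ t ≡.refl))) ⟩
    cubic (suc r ℕ.+ M) - cubic r                         ∎
    where
    arith₁ : ∀ t m → suc (2 ℕ.+ t ℕ.* 3) ℕ.* (2 ℕ.+ t ℕ.* 3 ℕ.+ m) ℕ.+ 0
           ≡ 3 ℕ.* t ℕ.* t ℕ.+ 4 ℕ.* t ℕ.+ 1 ℕ.+ suc t ℕ.* (suc (2 ℕ.+ t ℕ.* 3 ℕ.+ (2 ℕ.+ t ℕ.* 3)) ℕ.+ m ℕ.* 3)
    arith₁ = solve-∀
    arith₂ : ∀ t m → suc (2 ℕ.+ t ℕ.* 3) ℕ.+ m ℕ.* 3 ≡ suc (t ℕ.+ m) ℕ.* 3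
    arith₂ = solve-∀
  ... | 1+3* m | 0+3* t = begin
    scaledSchur r M                                       ≈⟨ scaledSchur₁ r m eq ⟩
    - pow q (suc ((2 ℕ.+ r) ℕ.* (r ℕ.+ m)))               ≈⟨ -‿cong (pow-mod eq m t (arith₁ t m)) ⟩
    - pow q (3 ℕ.* T ℕ.* T ℕ.+ 4 ℕ.* T ℕ.+ 1)             ≈⟨ solve 1 (λ x → :- x := :- x :- :0) refl _ ⟩
    - pow q (3 ℕ.* T ℕ.* T ℕ.+ 4 ℕ.* T ℕ.+ 1) - 0#        ≈⟨ sym (+-cong (cubic₂ T (arith₂ t m)) (-‿cong (cubic₀ t ≡.refl))) ⟩
    cubic (suc r ℕ.+ M) - cubic r                         ∎
    where
    T = t ℕ.+ m
    arith₁ : ∀ t m → suc ((2 ℕ.+ t ℕ.* 3) ℕ.* (t ℕ.* 3 ℕ.+ m)) ℕ.+ m ℕ.* (suc (t ℕ.* 3 ℕ.+ t ℕ.* 3) ℕ.+ (1 ℕ.+ m ℕ.* 3))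
           ≡ 3 ℕ.* (t ℕ.+ m) ℕ.* (t ℕ.+ m) ℕ.+ 4 ℕ.* (t ℕ.+ m) ℕ.+ 1 ℕ.+ t ℕ.* (suc (t ℕ.* 3 ℕ.+ t ℕ.* 3) ℕ.+ (1 ℕ.+ m ℕ.* 3))
    arith₁ = solve-∀
    arith₂ : ∀ t m → suc (t ℕ.* 3) ℕ.+ (1 ℕ.+ m ℕ.* 3) ≡ 2 ℕ.+ (t ℕ.+ m) ℕ.* 3
    arith₂ = solve-∀
  ... | 1+3* m | 1+3* t = begin
    scaledSchur r M                                       ≈⟨ scaledSchur₁ r m eq ⟩
    - pow q (suc ((2 ℕ.+ r) ℕ.* (r ℕ.+ m)))               ≈⟨ -‿cong (pow-mod eq 0 (suc t) (arith₁ t m)) ⟩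
    - pow q (3 ℕ.* t ℕ.* t ℕ.+ 2 ℕ.* t)                   ≈⟨ sym (+-identityˡ _) ⟩
    0# - pow q (3 ℕ.* t ℕ.* t ℕ.+ 2 ℕ.* t)                ≈⟨ sym (+-cong (cubic₀ (suc (t ℕ.+ m)) (arith₂ t m)) (-‿cong (cubic₁ t ≡.refl))) ⟩
    cubic (suc r ℕ.+ M) - cubic r                         ∎
    where
    arith₁ : ∀ t m → suc ((3 ℕ.+ t ℕ.* 3) ℕ.* (1 ℕ.+ t ℕ.* 3 ℕ.+ m)) ℕ.+ 0
           ≡ 3 ℕ.* t ℕ.* t ℕ.+ 2 ℕ.* t ℕ.+ suc t ℕ.* (suc (1 ℕ.+ t ℕ.* 3 ℕ.+ (1 ℕ.+ t ℕ.* 3)) ℕ.+ (1 ℕ.+ m ℕ.* 3))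
    arith₁ = solve-∀
    arith₂ : ∀ t m → suc (1 ℕ.+ t ℕ.* 3) ℕ.+ (1 ℕ.+ m ℕ.* 3) ≡ suc (t ℕ.+ m) ℕ.* 3
    arith₂ = solve-∀
  ... | 1+3* m | 2+3* t = begin
    scaledSchur r M                                       ≈⟨ scaledSchur₁ r m eq ⟩
    - pow q (suc ((2 ℕ.+ r) ℕ.* (r ℕ.+ m)))               ≈⟨ -‿cong (pow-mod eq 0 (suc t) (arith₁ t m)) ⟩
    -- Again s = N/3 and b is the exponent in V_r; now the middle power of the three-term relation
    -- is replaced.
    - pow q (b ℕ.+ s)                                     ≈⟨ solve 3 (λ x y z → :- y := z :- :- x :- (x :+ y :+ z)) refl (pow q b) _ (pow q (b ℕ.+ (s ℕ.+ s))) ⟩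
    pow q (b ℕ.+ (s ℕ.+ s)) - - pow q b - (pow q b + pow q (b ℕ.+ s) + pow q (b ℕ.+ (s ℕ.+ s)))
      ≈⟨ +-congˡ (-‿cong (pow-third s b (≡.trans (arith₂ t m) eq))) ⟩
    pow q (b ℕ.+ (s ℕ.+ s)) - - pow q b - 0#              ≈⟨ solve 2 (λ x z → z :- :- x :- :0 := z :- :- x) refl _ _ ⟩
    pow q (b ℕ.+ (s ℕ.+ s)) - - pow q b                   ≈⟨ +-congʳ (pow-mod eq m 0 (arith₃ t m)) ⟩
    pow q (3 ℕ.* T ℕ.* T ℕ.+ 2 ℕ.* T) - - pow q b         ≈⟨ sym (+-cong (cubic₁ T (arith₄ t m)) (-‿cong (cubic₂ t ≡.refl))) ⟩
    cubic (suc r ℕ.+ M) - cubic r                         ∎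
    where
    T = suc (t ℕ.+ m)
    s = 2 ℕ.* t ℕ.+ 2 ℕ.+ m
    b = 3 ℕ.* t ℕ.* t ℕ.+ 4 ℕ.* t ℕ.+ 1
    arith₁ : ∀ t m → suc ((4 ℕ.+ t ℕ.* 3) ℕ.* (2 ℕ.+ t ℕ.* 3 ℕ.+ m)) ℕ.+ 0
           ≡ 3 ℕ.* t ℕ.* t ℕ.+ 4 ℕ.* t ℕ.+ 1 ℕ.+ (2 ℕ.* t ℕ.+ 2 ℕ.+ m)
             ℕ.+ suc t ℕ.* (suc (2 ℕ.+ t ℕ.* 3 ℕ.+ (2 ℕ.+ t ℕ.* 3)) ℕ.+ (1 ℕ.+ m ℕ.* 3))
    arith₁ = solve-∀
    arith₂ : ∀ t m → (2 ℕ.* t ℕ.+ 2 ℕ.+ m) ℕ.* 3 ≡ suc (2 ℕ.+ t ℕ.* 3 ℕ.+ (2 ℕ.+ t ℕ.* 3)) ℕ.+ (1 ℕ.+ m ℕ.* 3)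
    arith₂ = solve-∀
    arith₃ : ∀ t m → 3 ℕ.* t ℕ.* t ℕ.+ 4 ℕ.* t ℕ.+ 1 ℕ.+ (2 ℕ.* t ℕ.+ 2 ℕ.+ m ℕ.+ (2 ℕ.* t ℕ.+ 2 ℕ.+ m))
             ℕ.+ m ℕ.* (suc (2 ℕ.+ t ℕ.* 3 ℕ.+ (2 ℕ.+ t ℕ.* 3)) ℕ.+ (1 ℕ.+ m ℕ.* 3))
           ≡ 3 ℕ.* suc (t ℕ.+ m) ℕ.* suc (t ℕ.+ m) ℕ.+ 2 ℕ.* suc (t ℕ.+ m) ℕ.+ 0
    arith₃ = solve-∀
    arith₄ : ∀ t m → suc (2 ℕ.+ t ℕ.* 3) ℕ.+ (1 ℕ.+ m ℕ.* 3) ≡ 1 ℕ.+ suc (t ℕ.+ m) ℕ.* 3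
    arith₄ = solve-∀
  ... | 2+3* m | 0+3* t = begin
    scaledSchur r M                  ≈⟨ scaledSchur₂ r m eq ⟩
    0#                               ≈⟨ sym (-‿inverseʳ 0#) ⟩
    0# - 0#                          ≈⟨ sym (+-cong (cubic₀ (suc (t ℕ.+ m)) (arith t m)) (-‿cong (cubic₀ t ≡.refl))) ⟩
    cubic (suc r ℕ.+ M) - cubic r    ∎
    where
    arith : ∀ t m → suc (t ℕ.* 3) ℕ.+ (2 ℕ.+ m ℕ.* 3) ≡ suc (t ℕ.+ m) ℕ.* 3
    arith = solve-∀
  ... | 2+3* m | 1+3* t = begin
    scaledSchur r M                                   ≈⟨ scaledSchur₂ r m eq ⟩
    0#                                                ≈⟨ sym (-‿inverseʳ (pow q b)) ⟩
    pow q b - pow q b                                 ≈⟨ +-congʳ (pow-mod eq (suc m) 0 (arith₁ t m)) ⟩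
    pow q (3 ℕ.* T ℕ.* T ℕ.+ 2 ℕ.* T) - pow q b       ≈⟨ sym (+-cong (cubic₁ T (arith₂ t m)) (-‿cong (cubic₁ t ≡.refl))) ⟩
    cubic (suc r ℕ.+ M) - cubic r                     ∎
    where
    T = suc (t ℕ.+ m)
    b = 3 ℕ.* t ℕ.* t ℕ.+ 2 ℕ.* t
    arith₁ : ∀ t m → 3 ℕ.* t ℕ.* t ℕ.+ 2 ℕ.* t ℕ.+ suc m ℕ.* (suc (1 ℕ.+ t ℕ.* 3 ℕ.+ (1 ℕ.+ t ℕ.* 3)) ℕ.+ (2 ℕ.+ m ℕ.* 3))
           ≡ 3 ℕ.* suc (t ℕ.+ m) ℕ.* suc (t ℕ.+ m) ℕ.+ 2 ℕ.* suc (t ℕ.+ m) ℕ.+ 0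
    arith₁ = solve-∀
    arith₂ : ∀ t m → suc (1 ℕ.+ t ℕ.* 3) ℕ.+ (2 ℕ.+ m ℕ.* 3) ≡ 1 ℕ.+ suc (t ℕ.+ m) ℕ.* 3
    arith₂ = solve-∀
  ... | 2+3* m | 2+3* t = begin
    scaledSchur r M                                   ≈⟨ scaledSchur₂ r m eq ⟩
    0#                                                ≈⟨ sym (-‿inverseʳ (- pow q b)) ⟩
    - pow q b - - pow q b                             ≈⟨ +-congʳ (-‿cong (pow-mod eq (suc m) 0 (arith₁ t m))) ⟩
    - pow q (3 ℕ.* T ℕ.* T ℕ.+ 4 ℕ.* T ℕ.+ 1) - - pow q b
      ≈⟨ sym (+-cong (cubic₂ T (arith₂ t m)) (-‿cong (cubic₂ t ≡.refl))) ⟩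
    cubic (suc r ℕ.+ M) - cubic r                     ∎
    where
    T = suc (t ℕ.+ m)
    b = 3 ℕ.* t ℕ.* t ℕ.+ 4 ℕ.* t ℕ.+ 1
    arith₁ : ∀ t m → 3 ℕ.* t ℕ.* t ℕ.+ 4 ℕ.* t ℕ.+ 1 ℕ.+ suc m ℕ.* (suc (2 ℕ.+ t ℕ.* 3 ℕ.+ (2 ℕ.+ t ℕ.* 3)) ℕ.+ (2 ℕ.+ m ℕ.* 3))
           ≡ 3 ℕ.* suc (t ℕ.+ m) ℕ.* suc (t ℕ.+ m) ℕ.+ 4 ℕ.* suc (t ℕ.+ m) ℕ.+ 1 ℕ.+ 0
    arith₁ = solve-∀
    arith₂ : ∀ t m → suc (2 ℕ.+ t ℕ.* 3) ℕ.+ (2 ℕ.+ m ℕ.* 3) ≡ 2 ℕ.+ suc (t ℕ.+ m) ℕ.* 3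
    arith₂ = solve-∀

  -- Termination of the series H.

  qPoch-zero : ∀ a l k y → k < l → a ℕ.+ k ≡ y ℕ.* N → qPoch q (pow q a) l ≈ 0#
  qPoch-zero a l k y k<l eq with ℕₚ.m≤n⇒∃[o]m+o≡n k<l
  ... | (d , ≡.refl) = begin
    qPoch q (pow q a) (suc k ℕ.+ d)
      ≈⟨ qPoch-+ (pow q a) (suc k) d ⟩
    qPoch q (pow q a) k * (1# - pow q a * pow q k) * P
      ≈⟨ *-congʳ (*-congˡ (+-congˡ (-‿cong (trans (pow-*₂ q a k eq) (pow-N* y))))) ⟩
    qPoch q (pow q a) k * (1# - 1#) * P
      ≈⟨ solve 2 (λ u v → u :* (:1 :- :1) :* v := :0) refl _ P ⟩
    0# ∎
    where
    P = qPoch q (pow q a * pow q (suc k)) d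

  -- The exponents n+1, ..., 2n include a multiple of N: N itself if n < N, and otherwise some
  -- multiple since the window has at least N elements. The series thus stops exactly where the
  -- range 2n < N of `BaileyPair` ends.
  qPoch-central-zero : ∀ n → N ≤ n ℕ.+ n → qPoch q (pow q (suc n)) n ≈ 0#
  qPoch-central-zero n N≤2n with n ℕ.<? N
  ... | no n≮N with multipleInWindow N {{ℕ.>-nonZero 1≤N}} (suc n) n (ℕₚ.≮⇒≥ n≮N)
  ...   | k , k<n , y , eq = qPoch-zero (suc n) n k y k<n eq
  qPoch-central-zero n N≤2n | yes n<N with ℕₚ.m≤n⇒∃[o]m+o≡n n<N
  ... | (k , n+1+k≡N) = qPoch-zero (suc n) n k 1
    (ℕₚ.+-cancelˡ-≤ n (suc k) n (ℕₚ.≤-trans (ℕₚ.≤-reflexive (≡.trans (ℕₚ.+-suc n k) n+1+k≡N)) N≤2n))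
    (≡.trans n+1+k≡N (≡.sym (ℕₚ.*-identityˡ N)))

  -- The weights and their symmetry.

  weight : ℕ → ℕ → Carrier
  weight j k = pow (- 1#) k * pow q (triangle (suc k) ℕ.+ j ℕ.* (k ℕ.* k ℕ.+ k))

  -- Modulo N the map k → k′ is k → -1-k, which fixes k² + k. For the half k(k+1)/2 a sign
  -- intervenes, and it is matched by (-1)^(N-1) = q^(N(N-1)/2) from `pow-half`.
  weight-sym : ∀ j k k′ → suc (k ℕ.+ k′) ≡ N → weight j k ≈ weight j k′
  weight-sym j k k′ eq = begin
    s * pow q (A ℕ.+ j ℕ.* (k ℕ.* k ℕ.+ k))
      ≈⟨ *-congˡ (pow-+ q A _) ⟩
    s * (pow q A * pow q (j ℕ.* (k ℕ.* k ℕ.+ k)))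
      ≈⟨ trans (sym (*-assoc _ _ _)) (*-cong half (pow-mod eq (j ℕ.* k′) (j ℕ.* k) (arith₄ j k k′))) ⟩
    s′ * pow q A′ * pow q (j ℕ.* (k′ ℕ.* k′ ℕ.+ k′))
      ≈⟨ trans (*-assoc _ _ _) (*-congˡ (sym (pow-+ q A′ _))) ⟩
    s′ * pow q (A′ ℕ.+ j ℕ.* (k′ ℕ.* k′ ℕ.+ k′)) ∎
    where
    s = pow (- 1#) k
    s′ = pow (- 1#) k′
    A = triangle (suc k)
    A′ = triangle (suc k′)
    B = A ℕ.+ triangle k′ ℕ.+ suc k ℕ.* k′
    signs : s * s′ ≈ pow q B
    signs = begin
      s * s′                          ≈⟨ sym (pow-+ (- 1#) k k′) ⟩
      pow (- 1#) (k ℕ.+ k′)           ≈⟨ sym (pow-half (k ℕ.+ k′) (triangle (suc (k ℕ.+ k′))) (≡.trans (triangle-double (k ℕ.+ k′)) (≡.cong ((k ℕ.+ k′) ℕ.*_) eq))) ⟩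
      pow q (triangle (suc k ℕ.+ k′)) ≈⟨ pow-≡ q (triangle-+ (suc k) k′) ⟩
      pow q B                         ∎
    arith₁ : ∀ A k t k′ → A ℕ.+ t ℕ.+ suc k ℕ.* k′ ℕ.+ A ≡ A ℕ.+ A ℕ.+ (t ℕ.+ suc k ℕ.* k′)
    arith₁ = solve-∀
    arith₂ : ∀ k t k′ → k ℕ.* suc k ℕ.+ (t ℕ.+ suc k ℕ.* k′) ℕ.+ 1 ℕ.* suc (k ℕ.+ k′) ≡ k′ ℕ.+ t ℕ.+ suc k ℕ.* suc (k ℕ.+ k′)
    arith₂ = solve-∀
    arith₄ : ∀ j k k′ → j ℕ.* (k ℕ.* k ℕ.+ k) ℕ.+ j ℕ.* k′ ℕ.* suc (k ℕ.+ k′) ≡ j ℕ.* (k′ ℕ.* k′ ℕ.+ k′) ℕ.+ j ℕ.* k ℕ.* suc (k ℕ.+ k′)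
    arith₄ = solve-∀
    half : s * pow q A ≈ s′ * pow q A′
    half = begin
      s * pow q A                    ≈⟨ sym (trans (*-congʳ (sign² k′)) (*-identityˡ _)) ⟩
      s′ * s′ * (s * pow q A)        ≈⟨ solve 3 (λ s s′ a → s′ :* s′ :* (s :* a) := s′ :* (s :* s′ :* a)) refl s s′ _ ⟩
      s′ * (s * s′ * pow q A)        ≈⟨ *-congˡ (*-congʳ signs) ⟩
      s′ * (pow q B * pow q A)       ≈⟨ *-congˡ (pow-*₂ q B A (≡.trans (arith₁ A k (triangle k′) k′) (≡.cong (ℕ._+ (triangle k′ ℕ.+ suc k ℕ.* k′)) (triangle-double k)))) ⟩
      s′ * pow q (k ℕ.* suc k ℕ.+ (triangle k′ ℕ.+ suc k ℕ.* k′)) ≈⟨ *-congˡ (pow-mod eq 1 (suc k) (arith₂ k (triangle k′) k′)) ⟩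
      s′ * pow q A′                  ∎

  -- The bounds say h = ⌈N/2⌉. The case r = K, that is N = 2r, stands apart because M = N - 1 - 2r
  -- would be negative; there every term vanishes and the two cubic values coincide.
  centralSum≈cubic-difference : ∀ h r K → N ≤ h ℕ.+ h → h ℕ.+ h ≤ suc N → r ℕ.+ K ≡ N → r ≤ K →
    centralSum h r ≈ cubic K - cubic r
  centralSum≈cubic-difference h r K N≤2h 2h≤1+N r+K≡N r≤K with ℕₚ.m≤n⇒m<n∨m≡n r≤K
  ... | inj₂ ≡.refl = begin
    centralSum h r ≡⟨ ≡.cong (λ h → centralSum h r) h≡r ⟩
    centralSum r r ≈⟨ centralSum-end r ⟩
    0#             ≈⟨ sym (-‿inverseʳ (cubic r)) ⟩
    cubic r - cubic r ∎
    where
    h≡r : h ≡ r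
    h≡r = ℕₚ.≤-antisym
      (m+m≤1+n+n⇒m≤n h r (≡.subst (λ n → h ℕ.+ h ≤ suc n) (≡.sym r+K≡N) 2h≤1+N))
      (m+m≤1+n+n⇒m≤n r h (ℕₚ.m≤n⇒m≤1+n (≡.subst (_≤ h ℕ.+ h) (≡.sym r+K≡N) N≤2h)))
  ... | inj₁ r<K with ℕₚ.m≤n⇒∃[o]m+o≡n r<K
                    | ℕₚ.m≤n⇒∃[o]m+o≡n (m+m≤1+n+n⇒m≤n r h (ℕₚ.m≤n⇒m≤1+n (ℕₚ.≤-trans (ℕₚ.≤-trans (ℕₚ.+-monoʳ-≤ r r≤K) (ℕₚ.≤-reflexive r+K≡N)) N≤2h)))
  ...   | (M , ≡.refl) | (B , ≡.refl) = trans (centralSum-schur r B M eq M<2B 2B≤2+M) (scaledSchur≈cubic-difference r M eq)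
    where
    eq : suc (r ℕ.+ r) ℕ.+ M ≡ N
    eq = ≡.trans (arith r M) r+K≡N
      where
      arith : ∀ r M → suc (r ℕ.+ r) ℕ.+ M ≡ r ℕ.+ suc (r ℕ.+ M)
      arith = solve-∀
    arith₁ : ∀ r M → r ℕ.+ r ℕ.+ suc M ≡ suc (r ℕ.+ r) ℕ.+ M
    arith₁ = solve-∀
    arith₂ : ∀ r B → r ℕ.+ B ℕ.+ (r ℕ.+ B) ≡ r ℕ.+ r ℕ.+ (B ℕ.+ B)
    arith₂ = solve-∀
    arith₃ : ∀ r M → suc (suc (r ℕ.+ r) ℕ.+ M) ≡ r ℕ.+ r ℕ.+ (2 ℕ.+ M)
    arith₃ = solve-∀
    M<2B : M < B ℕ.+ B
    M<2B = ℕₚ.+-cancelˡ-≤ (r ℕ.+ r) (suc M) (B ℕ.+ B)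
      (ℕₚ.≤-trans (ℕₚ.≤-reflexive (≡.trans (arith₁ r M) eq)) (ℕₚ.≤-trans N≤2h (ℕₚ.≤-reflexive (arith₂ r B))))
    2B≤2+M : B ℕ.+ B ≤ 2 ℕ.+ M
    2B≤2+M = ℕₚ.+-cancelˡ-≤ (r ℕ.+ r) (B ℕ.+ B) (2 ℕ.+ M)
      (ℕₚ.≤-trans (ℕₚ.≤-reflexive (≡.sym (arith₂ r B))) (ℕₚ.≤-trans 2h≤1+N (ℕₚ.≤-reflexive (≡.trans (≡.cong suc (≡.sym eq)) (arith₃ r M)))))

  -- Assembly: interchange of sums and pairing of indices.

  -- With h = ⌈N/2⌉ the condition n < h is 2n < N, so the surviving terms are those governed by
  -- `innerPair`. Extending the r-sum to the common bound h, where `ballot` vanishes for r > n,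
  -- makes the interchange rectangular.
  Htrunc≈weighted-centralSums : ∀ j h M → N ≤ h ℕ.+ h → h ℕ.+ h ≤ suc N → N ≤ M →
    Htrunc q (suc j) M ≈ sumBelow h (λ r → weight j r * (centralSum h r - centralSum h (suc r)))
  Htrunc≈weighted-centralSums j h M N≤2h 2h≤1+N N≤M = begin
    Htrunc q (suc j) M
      ≈⟨ sumTo≈sumBelow M _ ⟩
    sumBelow (suc M) (λ n → pow q n * qPoch q (pow q (suc n)) n * inner q j n)
      ≈⟨ sum-extend _ h≤1+M (λ n h≤n _ → trans (*-congʳ (trans (*-congˡ (qPoch-central-zero n (ℕₚ.≤-trans N≤2h (ℕₚ.+-mono-≤ h≤n h≤n)))) (zeroʳ _))) (zeroˡ _)) ⟩
    sumBelow h (λ n → pow q n * qPoch q (pow q (suc n)) n * inner q j n)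
      ≈⟨ sum-cong< h row ⟩
    sumBelow h (λ n → sumBelow h (λ r → weight j r * (u r n - u (suc r) n)))
      ≈⟨ sum-swap h h _ ⟩
    sumBelow h (λ r → sumBelow h (λ n → weight j r * (u r n - u (suc r) n)))
      ≈⟨ sum-cong h (λ r → trans (sum-*ˡ h (weight j r) _) (*-congˡ (sum-- h (u r) (u (suc r))))) ⟩
    sumBelow h (λ r → weight j r * (centralSum h r - centralSum h (suc r))) ∎
    where
    u : ℕ → ℕ → Carrier
    u r n = pow q (n ℕ.+ r ℕ.* r) * qBinom q (n ℕ.+ n) (n ℕ.+ r)
    h≤1+M : h ≤ suc M
    h≤1+M = ℕₚ.m≤n⇒m≤1+n (ℕₚ.≤-trans (m+m≤1+n+n⇒m≤n h N (ℕₚ.≤-trans 2h≤1+N (s≤s (ℕₚ.m≤m+n N N)))) N≤M)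
    entry : ∀ n r → pow q n * (unitα (suc j) r * ballot n r) ≈ weight j r * (u r n - u (suc r) n)
    entry n r = begin
      pow q n * (s * pow q (triangle r ℕ.+ suc j ℕ.* (r ℕ.* suc r)) * (b - pow q (suc (r ℕ.+ r)) * b′))
        ≈⟨ *-congˡ (*-congʳ (*-congˡ (trans (pow-≡ q (arith₁ j r (triangle r))) (pow-+ q (triangle (suc r) ℕ.+ j ℕ.* (r ℕ.* r ℕ.+ r)) _)))) ⟩
      pow q n * (s * (e * pow q (r ℕ.* r)) * (b - pow q (suc (r ℕ.+ r)) * b′))
        ≈⟨ solve 7 (λ n s e r b v b′ → n :* (s :* (e :* r) :* (b :- v :* b′)) := s :* e :* (n :* r :* b :- n :* r :* v :* b′)) refl _ s e _ b _ b′ ⟩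
      s * e * (pow q n * pow q (r ℕ.* r) * b - pow q n * pow q (r ℕ.* r) * pow q (suc (r ℕ.+ r)) * b′)
        -- As r² + (2r+1) = (r+1)², the second q-binomial of `ballot` is the first with r + 1 in
        -- place of r.
        ≈⟨ *-congˡ (+-cong (*-congʳ (sym (pow-+ q n (r ℕ.* r))))
             (-‿cong (*-cong (pow-*₃ q n (r ℕ.* r) (suc (r ℕ.+ r)) (arith₂ n r)) (reflexive (≡.cong (qBinom q (n ℕ.+ n)) (≡.sym (ℕₚ.+-suc n r))))))) ⟩
      weight j r * (u r n - u (suc r) n) ∎
      where
      s = pow (- 1#) r
      e = pow q (triangle (suc r) ℕ.+ j ℕ.* (r ℕ.* r ℕ.+ r))
      b = qBinom q (n ℕ.+ n) (n ℕ.+ r)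
      b′ = qBinom q (n ℕ.+ n) (suc (n ℕ.+ r))
      arith₁ : ∀ j r t → t ℕ.+ suc j ℕ.* (r ℕ.* suc r) ≡ r ℕ.+ t ℕ.+ j ℕ.* (r ℕ.* r ℕ.+ r) ℕ.+ r ℕ.* r
      arith₁ = solve-∀
      arith₂ : ∀ n r → n ℕ.+ r ℕ.* r ℕ.+ suc (r ℕ.+ r) ≡ n ℕ.+ suc r ℕ.* suc r
      arith₂ = solve-∀
    row : ∀ n → n < h → pow q n * qPoch q (pow q (suc n)) n * inner q j n ≈ sumBelow h (λ r → weight j r * (u r n - u (suc r) n))
    row n n<h = begin
      pow q n * qPoch q (pow q (suc n)) n * inner q j n
        ≈⟨ *-assoc _ _ _ ⟩
      pow q n * (qPoch q (pow q (suc n)) n * inner q j n)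
        ≈⟨ *-congˡ (innerPair j n 2n<N) ⟩
      pow q n * sumBelow (suc n) (λ r → unitα (suc j) r * ballot n r)
        ≈⟨ *-congˡ (sym (sum-extend _ n<h (λ r n<r _ → trans (*-congˡ (ballot-zero n<r)) (zeroʳ _)))) ⟩
      pow q n * sumBelow h (λ r → unitα (suc j) r * ballot n r)
        ≈⟨ sym (sum-*ˡ h (pow q n) _) ⟩
      sumBelow h (λ r → pow q n * (unitα (suc j) r * ballot n r))
        ≈⟨ sum-cong h (entry n) ⟩
      sumBelow h (λ r → weight j r * (u r n - u (suc r) n)) ∎
      where
      2n<N : n ℕ.+ n < N
      2n<N = ℕₚ.≤-pred (ℕₚ.≤-trans (ℕₚ.≤-reflexive (≡.cong suc (≡.sym (ℕₚ.+-suc n n)))) (ℕₚ.≤-trans (ℕₚ.+-mono-≤ n<h n<h) 2h≤1+N))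

  rhs≈weighted-alphas : ∀ j → rhs q (suc j) N ≈ sumBelow N (λ k → weight j k * alpha q k)
  rhs≈weighted-alphas j = sum-cong N (λ k → *-congʳ (*-congˡ (pow-≡ q (≡.cong (ℕ._+ j ℕ.* (k ℕ.* k ℕ.+ k)) (C2≡triangle (suc k))))))

  -- Four cubic values occur, at k, k+1, k′ and k′+1 = N - k; grouping them by neighbours instead of
  -- by reflection gives the two α.
  weighted-pair : ∀ j h k k′ → N ≤ h ℕ.+ h → h ℕ.+ h ≤ suc N → suc (k ℕ.+ k′) ≡ N → k < k′ →
    weight j k * (centralSum h k - centralSum h (suc k)) ≈ weight j k * alpha q k + weight j k′ * alpha q k′
  weighted-pair j h k k′ N≤2h 2h≤1+N eq k<k′ = begin
    w * (centralSum h k - centralSum h (suc k))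
      ≈⟨ *-congˡ (+-cong (centralSum≈cubic-difference h k (suc k′) N≤2h 2h≤1+N (≡.trans (ℕₚ.+-suc k k′) eq) (ℕₚ.m≤n⇒m≤1+n (ℕₚ.<⇒≤ k<k′)))
                         (-‿cong (centralSum≈cubic-difference h (suc k) k′ N≤2h 2h≤1+N eq k<k′))) ⟩
    w * (cubic (suc k′) - cubic k - (cubic k′ - cubic (suc k)))
      ≈⟨ solve 5 (λ w a b c d → w :* (a :- b :- (c :- d)) := w :* (d :- b) :+ w :* (a :- c)) refl w _ _ _ _ ⟩
    w * (cubic (suc k) - cubic k) + w * (cubic (suc k′) - cubic k′)
      ≈⟨ sym (+-cong (*-congˡ (alpha≈cubic-difference k)) (*-cong (sym (weight-sym j k k′ eq)) (alpha≈cubic-difference k′))) ⟩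
    w * alpha q k + weight j k′ * alpha q k′ ∎
    where
    w = weight j k

  Htrunc≈rhs : ∀ j M → N ≤ M → Htrunc q (suc j) M ≈ rhs q (suc j) N
  Htrunc≈rhs j M N≤M with parity N | ≡.refl {x = N}
  ... | even h | 2h≡N = begin
    Htrunc q (suc j) M
      ≈⟨ Htrunc≈weighted-centralSums j h M N≤2h 2h≤1+N N≤M ⟩
    sumBelow h (λ k → weight j k * (centralSum h k - centralSum h (suc k)))
      ≈⟨ sum-cong< h (λ k k<h → weighted-pair j h k (h ℕ.+ (h ∸ suc k)) N≤2h 2h≤1+N
           (≡.trans (arith k h (h ∸ suc k)) (≡.cong (h ℕ.+_) (ℕₚ.m+[n∸m]≡n k<h))) (ℕₚ.≤-trans k<h (ℕₚ.m≤m+n h _))) ⟩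
    sumBelow h (λ k → f k + f (h ℕ.+ (h ∸ suc k)))
      ≈⟨ sum-+ h _ _ ⟩
    sumBelow h f + sumBelow h (λ k → f (h ℕ.+ (h ∸ suc k)))
      ≈⟨ +-congˡ (sym (sum-reverse h (λ k → f (h ℕ.+ k)))) ⟩
    sumBelow h f + sumBelow h (λ k → f (h ℕ.+ k))
      ≈⟨ sym (sum-split h h f) ⟩
    sumBelow (h ℕ.+ h) f
      ≈⟨ sym (rhs≈weighted-alphas j) ⟩
    rhs q (suc j) N ∎
    where
    f : ℕ → Carrier
    f k = weight j k * alpha q k
    N≤2h : N ≤ h ℕ.+ h
    N≤2h = ℕₚ.≤-reflexive (≡.sym 2h≡N)
    2h≤1+N : h ℕ.+ h ≤ suc N
    2h≤1+N = ℕₚ.m≤n⇒m≤1+n (ℕₚ.≤-reflexive 2h≡N)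
    arith : ∀ k h d → suc (k ℕ.+ (h ℕ.+ d)) ≡ h ℕ.+ (suc k ℕ.+ d)
    arith = solve-∀
  -- For N = 2g + 1 the index g is its own partner: U_(g+1) vanishes there, and α_g is counted once.
  ... | odd g | 2g+1≡N = begin
    Htrunc q (suc j) M
      ≈⟨ Htrunc≈weighted-centralSums j h M N≤2h 2h≤1+N N≤M ⟩
    sumBelow g (λ k → weight j k * (centralSum h k - centralSum h (suc k))) + weight j g * (centralSum h g - centralSum h h)
      ≈⟨ +-cong (sum-cong< g (λ k k<g → weighted-pair j h k (g ℕ.+ suc (g ∸ suc k)) N≤2h 2h≤1+N
           (≡.trans (arith k g (g ∸ suc k)) (≡.cong (λ x → suc (g ℕ.+ x)) (ℕₚ.m+[n∸m]≡n k<g))) (ℕₚ.≤-trans k<g (ℕₚ.m≤m+n g _)))) (*-congˡ middle) ⟩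
    sumBelow g (λ k → f k + f (g ℕ.+ suc (g ∸ suc k))) + f g
      ≈⟨ +-congʳ (sum-+ g _ _) ⟩
    sumBelow g f + sumBelow g (λ k → f (g ℕ.+ suc (g ∸ suc k))) + f g
      ≈⟨ +-congʳ (+-congˡ (sym (sum-reverse g (λ k → f (g ℕ.+ suc k))))) ⟩
    sumBelow g f + sumBelow g (λ k → f (g ℕ.+ suc k)) + f g
      ≈⟨ solve 3 (λ a b c → a :+ b :+ c := a :+ (c :+ b)) refl _ _ _ ⟩
    sumBelow g f + (f g + sumBelow g (λ k → f (g ℕ.+ suc k)))
      ≈⟨ +-congˡ (+-congʳ (reflexive (≡.cong f (≡.sym (ℕₚ.+-identityʳ g))))) ⟩
    sumBelow g f + (f (g ℕ.+ 0) + sumBelow g (λ k → f (g ℕ.+ suc k)))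
      ≈⟨ +-congˡ (sym (sum-head g (λ k → f (g ℕ.+ k)))) ⟩
    sumBelow g f + sumBelow (suc g) (λ k → f (g ℕ.+ k))
      ≈⟨ sym (sum-split g (suc g) f) ⟩
    sumBelow (g ℕ.+ suc g) f
      ≡⟨ ≡.cong (λ n → sumBelow n f) (ℕₚ.+-suc g g) ⟩
    sumBelow (suc (g ℕ.+ g)) f
      ≈⟨ sym (rhs≈weighted-alphas j) ⟩
    rhs q (suc j) N ∎
    where
    h = suc g
    f : ℕ → Carrier
    f k = weight j k * alpha q k
    2h≡1+N : h ℕ.+ h ≡ suc N
    2h≡1+N = ≡.trans (≡.cong suc (ℕₚ.+-suc g g)) (≡.cong suc 2g+1≡N)
    N≤2h : N ≤ h ℕ.+ h
    N≤2h = ℕₚ.≤-trans (ℕₚ.n≤1+n N) (ℕₚ.≤-reflexive (≡.sym 2h≡1+N))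
    2h≤1+N : h ℕ.+ h ≤ suc N
    2h≤1+N = ℕₚ.≤-reflexive 2h≡1+N
    arith : ∀ k g d → suc (k ℕ.+ (g ℕ.+ suc d)) ≡ suc (g ℕ.+ (suc k ℕ.+ d))
    arith = solve-∀
    middle : centralSum h g - centralSum h h ≈ alpha q g
    middle = begin
      centralSum h g - centralSum h h
        ≈⟨ +-cong (centralSum≈cubic-difference h g h N≤2h 2h≤1+N (≡.trans (ℕₚ.+-suc g g) 2g+1≡N) (ℕₚ.n≤1+n g)) (-‿cong (centralSum-end h)) ⟩
      cubic (suc g) - cubic g - 0#
        ≈⟨ solve 2 (λ a b → a :- b :- :0 := a :- b) refl _ _ ⟩
      cubic (suc g) - cubic g
        ≈⟨ sym (alpha≈cubic-difference g) ⟩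
      alpha q g ∎

theorem2p10 : ∀ {c ℓ : Level} (R : CommutativeRing c ℓ) →
    let open CommutativeRing R in let open WithRing R in
    ¬ (1# ≈ 0#) →
    (∀ x y → x * y ≈ 0# → x ≈ 0# ⊎ y ≈ 0#) →
    (p N : ℕ) → 1 ≤ p → 1 ≤ N →
    (q : Carrier) → pow q N ≈ 1# → (∀ j → 1 ≤ j → j < N → ¬ (pow q j ≈ 1#)) →
    (M : ℕ) → N ≤ M →
    Htrunc q p M ≈ rhs q p N
theorem2p10 R 1≉0 integral (suc j) N _ 1≤N q q^N≈1 q^j≉1 M N≤M =
  RootOfUnity.Htrunc≈rhs R 1≉0 integral N 1≤N q (q^N≈1 , q^j≉1) j M N≤M
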